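{- Let $k, r\geq 2$ be integers. There exist constants $C, c>0$ (depending only on $k$ and $r$) such that if $G$ is an $n$-vertex linear $r$-graph with $\mathrm{e}(G)\geq Cn^{1+1/k}$, then $G$ contains at least $c\left(\frac{\mathrm{e}(G)}{n}\right)^{2k}$ copies of $C^{(r)}_{2k}$.
   Context: An $r$-graph is an $r$-uniform hypergraph; $\mathrm{e}(G)$ denotes its number of edges. An $r$-graph is linear if any two distinct edges share at most one vertex. The $r$-uniform linear cycle $C^{(r)}_{m}$ of length $m$ is obtained from a $2$-uniform cycle $v_1v_2\dots v_mv_1$ by extending each edge $v_iv_{i+1}$ (indices mod $m$) to the $r$-set $\{v_i,v_{i+1}\}\cup I_i$, where $I_1,\dots,I_m$ are pairwise disjoint $(r-2)$-sets of new vertices. A copy of $H$ in $G$ is a subgraph of $G$ isomorphic to $H$. -}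

module Defs where

open import Data.Nat using (ℕ; zero; suc; _≤_; _∸_; _%_)
open import Data.Nat.DivMod using (m%n<n)
open import Data.Fin using (Fin; toℕ; fromℕ<)
open import Data.Fin.Subset using (Subset; _∈_; _∩_; ∣_∣)
open import Data.Sum using (_⊎_; inj₁; inj₂)
open import Data.Product using (_×_; _,_; Σ; ∃)
open import Data.Integer using (+_)
open import Data.Rational using (ℚ; _/_; _*_; 1ℚ)
open import Function.Definitions using (Injective)
open import Relation.Binary.PropositionalEquality using (_≡_; _≢_)
open import Function.Bundles using (_⇔_)

_^ℚ_ : ℚ → ℕ → ℚ
q ^ℚ zero = 1ℚ
q ^ℚ suc n = q * (q ^ℚ n)

ℕ→ℚ : ℕ → ℚ
ℕ→ℚ n = + n / 1

record LinearGraph (r n : ℕ) : Set where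
  field
    m        : ℕ
    edge     : Fin m → Subset n
    distinct : Injective _≡_ _≡_ edge
    uniform  : ∀ i → ∣ edge i ∣ ≡ r
    linear   : ∀ i j → i ≢ j → ∣ edge i ∩ edge j ∣ ≤ 1
open LinearGraph public

next : ∀ {L} → Fin (suc L) → Fin (suc L)
next {L} i = fromℕ< (m%n<n (suc (toℕ i)) (suc L))

-- Vertices of the linear cycle C^{(r)}_{suc L}: core vertices v_i (inj₁ i)
-- and the new vertices of I_i (inj₂ (i , j)), j < r - 2.
CycleVertex : (L r : ℕ) → Set
CycleVertex L r = Fin (suc L) ⊎ (Fin (suc L) × Fin (r ∸ 2))

data InCycleEdge {L r : ℕ} (i : Fin (suc L)) : CycleVertex L r → Set where
  left  : InCycleEdge i (inj₁ i)
  right : InCycleEdge i (inj₁ (next i))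
  inner : ∀ j → InCycleEdge i (inj₂ (i , j))

-- S (a set of edges of G) is the edge set of a copy of C^{(r)}_{suc L} in G:
-- there is an injective vertex map φ from the cycle into G and an assignment
-- g of cycle edges to edges of G such that φ maps the i-th cycle edge into
-- (hence, by size, onto) edge (g i), and S is exactly the image of g.
IsCycleCopy : ∀ {r n} (L : ℕ) (G : LinearGraph r n) → Subset (m G) → Set
IsCycleCopy {r} {n} L G S =
  Σ (CycleVertex L r → Fin n) λ φ →
  Σ (Fin (suc L) → Fin (m G)) λ g →
    Injective _≡_ _≡_ φ
    × (∀ i x → InCycleEdge {L} {r} i x → φ x ∈ edge G (g i))
    × (∀ t → (t ∈ S) ⇔ (∃ λ i → g i ≡ t))

{-# OPTIONS --safe #-}

-- Let A be the adjacency matrix of the shadow graph of G, on n vertices with degrees d(x), and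
-- let M = e(G).  Weight a closed walk of length 2k by the product of 1/D(x) over its vertices,
-- where D(x) = n d(x) + M.  The walk operator normalised by D has an eigenvalue at least 1/(2n), so
-- the total weight T of these closed walks satisfies (2n)^(2k) T ≥ 1.  A closed walk
-- that meets itself improperly has, after rotation, a line x₀x₁ which meets the next k lines
-- outside x₁; there are at most k r² such x₀ for a given continuation.  Splitting the walk as x₀,
-- a k-step walk and a (k-1)-step walk, Cauchy–Schwarz bounds the square of the weight of the bad
-- walks by k r² T T' / (M n), where T' is the weight of the closed walks of length 2k - 2, and
-- T'^k ≤ n T^(k-1) by log-convexity.  Hence for M^k ≥ C^k n^(k+1) the good walks carry half
-- of T.  Each has weight at most M^(-2k), and each copy of the cycle supports at most (2kr)^(2k) of
-- them, whence the bound.  Weighting by D instead of counting walks removes any need to make G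
-- almost regular first.
--
-- To stay within ℕ all weights 1/D(x) are multiplied by K = ∏ D(x).

module Submission where

open import Defs
open import Algebra.Properties.CommutativeSemigroup using (interchange; x∙yz≈y∙xz; xy∙z≈y∙xz)
open import Data.Bool using (true; false)
open import Data.Bool.Properties using () renaming (_≟_ to _≟ᵇ_)
open import Data.Fin using (Fin; zero; suc; toℕ; fromℕ<)
open import Data.Fin.Properties using (any?; toℕ<n; toℕ-injective; toℕ-fromℕ<; suc-injective) renaming (_≟_ to _≟ᶠ_)
open import Data.Fin.Subset using (Subset; _∈_; _-_; ∣_∣)
open import Data.Fin.Subset.Properties using (_∈?_; ∣p∣≤n; x∈p∩q⁺; x∈p∧x≢y⇒x∈p-y; x∈p⇒∣p-x∣<∣p∣)
import Data.Integer as ℤ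
import Data.Integer.Properties as ℤ
open import Data.List using (List; []; _∷_; length; map; filter; allFin; cartesianProductWith; deduplicate) renaming (lookup to lookupᴸ)
open import Data.List.Membership.Propositional using () renaming (_∈_ to _∈ᴸ_)
open import Data.List.Membership.Propositional.Properties using (∈-cartesianProductWith⁺; ∈-allFin; ∈-filter⁺; ∈-map⁺; ∈-deduplicate⁺; ∈-lookup)
open import Data.List.Relation.Unary.All as All using (All; []; universal)
import Data.List.Relation.Unary.All.Properties as All
open import Data.List.Relation.Unary.AllPairs using ([])
open import Data.List.Relation.Unary.Any as Any using (here)
open import Data.List.Relation.Unary.Any.Properties using (lookup-index)
open import Data.List.Relation.Unary.Unique.DecPropositional.Properties using (deduplicate-!)
open import Data.List.Relation.Unary.Unique.Propositional using (Unique)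
open import Data.Nat using (ℕ; zero; suc; _≤_; _<_; _+_; _*_; _∸_; _^_; _%_; z≤n; s≤s; NonZero; ≢-nonZero; >-nonZero; >-nonZero⁻¹)
open import Data.Nat.Divisibility using (_∣_; quotient)
open import Data.Nat.DivMod using (m%n<n; m<n⇒m%n≡m; n%n≡0)
open import Data.Nat.ListAction using (product)
open import Data.Nat.ListAction.Properties using (∈⇒∣product; product≢0)
open import Data.Nat.Properties hiding (suc-injective)
open import Data.Nat.Tactic.RingSolver using (solve-∀)
open import Data.Product using (Σ; _×_; ∃; _,_; proj₁; proj₂)
open import Data.Rational using (ℚ; 0ℚ; 1ℚ; 1/_; toℚᵘ; Positive; NonNegative) renaming (_<_ to _<ℚ_; _≤_ to _≤ℚ_; _*_ to _*ℚ_; NonZero to NonZeroℚ)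
import Data.Rational.Properties as ℚ
open import Data.Rational.Unnormalised using (mkℚᵘ; *≤*; *≡*)
import Data.Rational.Unnormalised as ℚᵘ
import Data.Rational.Unnormalised.Properties as ℚᵘ
open import Data.Sum using (_⊎_; inj₁; inj₂)
open import Data.Unit using (⊤; tt)
open import Data.Vec using (Vec; []; _∷_; _++_; _∷ʳ_; head; lookup; tabulate)
open import Data.Vec.Properties using (≡-dec; lookup⇒[]=; []=⇒lookup; lookup∘tabulate)
open import Function using (it; _∘_)
open import Function.Bundles using (mk⇔; module Equivalence)
open import Function.Definitions using (Injective)
open import Relation.Binary.Definitions using (tri<; tri≈; tri>)
open import Relation.Binary.PropositionalEquality using (_≡_; _≢_; refl; sym; trans; cong; cong₂; subst; subst₂; module ≡-Reasoning)
open import Relation.Nullary using (Dec; yes; no; ¬_; does; _because_; contradiction; ¬?; _×-dec_; _⊎-dec_)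
open import Relation.Nullary.Decidable using (dec-true)

private
  variable
    X Y P Q : Set

  +-interchange = interchange +-commutativeSemigroup
  *-interchange = interchange *-commutativeSemigroup
  *-left-comm = x∙yz≈y∙xz *-commutativeSemigroup
  *-pull = xy∙z≈y∙xz *-commutativeSemigroup

-- Finite sums as positive linear functionals

record Linear {X : Set} (I : (X → ℕ) → ℕ) : Set where
  field
    mono  : ∀ {f g} → (∀ x → f x ≤ g x) → I f ≤ I g
    add   : ∀ f g → I (λ x → f x + g x) ≡ I f + I g
    scale : ∀ c f → I (λ x → c * f x) ≡ c * I f

  ext : ∀ {f g} → (∀ x → f x ≡ g x) → I f ≡ I g
  ext f≗g = ≤-antisym (mono λ x → ≤-reflexive (f≗g x)) (mono λ x → ≤-reflexive (sym (f≗g x)))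

  scaleʳ : ∀ c f → I (λ x → f x * c) ≡ I f * c
  scaleʳ c f = trans (ext λ x → *-comm (f x) c) (trans (scale c f) (*-comm c (I f)))

  null : I (λ _ → 0) ≡ 0
  null = scale 0 (λ _ → 0)

-- `fubini` ranges over all linear functionals `J`, not over integrals: the record then does not
-- refer to itself, and the property passes through densities, products and vectors by composition.
record Integral (X : Set) : Set₁ where
  field
    ∫        : (X → ℕ) → ℕ
    isLinear : Linear ∫
    fubini   : ∀ {Y : Set} {J : (Y → ℕ) → ℕ} → Linear J → ∀ (f : X → Y → ℕ) →
             ∫ (λ x → J (f x)) ≡ J (λ y → ∫ (λ x → f x y))
  open Linear isLinear public

open Integral using (∫)

swap : (I : Integral X) (J : Integral Y) (f : X → Y → ℕ) →
       ∫ I (λ x → ∫ J (f x)) ≡ ∫ J (λ y → ∫ I (λ x → f x y))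
swap I J = Integral.fubini I (Integral.isLinear J)

sumFin : ∀ n → (Fin n → ℕ) → ℕ
sumFin zero    f = 0
sumFin (suc n) f = f zero + sumFin n (λ i → f (suc i))

sumFin-mono : ∀ n {f g} → (∀ x → f x ≤ g x) → sumFin n f ≤ sumFin n g
sumFin-mono zero    h = z≤n
sumFin-mono (suc n) h = +-mono-≤ (h zero) (sumFin-mono n (λ i → h (suc i)))

sumFin-add : ∀ n f g → sumFin n (λ x → f x + g x) ≡ sumFin n f + sumFin n g
sumFin-add zero    f g = refl
sumFin-add (suc n) f g = trans (cong (f zero + g zero +_) (sumFin-add n (λ i → f (suc i)) (λ i → g (suc i)))) (+-interchange (f zero) (g zero) _ _)

sumFin-scale : ∀ n c f → sumFin n (λ x → c * f x) ≡ c * sumFin n f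
sumFin-scale zero    c f = sym (*-zeroʳ c)
sumFin-scale (suc n) c f =
  trans (cong (c * f zero +_) (sumFin-scale n c _)) (sym (*-distribˡ-+ c (f zero) _))

sumFin-fubini : ∀ n {J : (Y → ℕ) → ℕ} → Linear J → ∀ (f : Fin n → Y → ℕ) →
                sumFin n (λ x → J (f x)) ≡ J (λ y → sumFin n (λ x → f x y))
sumFin-fubini zero    J f = sym (Linear.null J)
sumFin-fubini (suc n) {J} lin f =
  trans (cong (J (f zero) +_) (sumFin-fubini n lin (λ i → f (suc i)))) (sym (Linear.add lin _ _))

counting : ∀ n → Integral (Fin n)
counting n = record
  { ∫ = sumFin n
  ; isLinear = record { mono = sumFin-mono n ; add = sumFin-add n ; scale = sumFin-scale n }
  ; fubini = sumFin-fubini n }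

trivial : Integral ⊤
trivial = record
  { ∫ = λ f → f tt
  ; isLinear = record { mono = λ h → h tt ; add = λ _ _ → refl ; scale = λ _ _ → refl }
  ; fubini = λ _ _ → refl }

-- The measure with density `μ`. Vertex weights will live here, so that the kernel can remain the
-- plain adjacency indicator.
weighted : (X → ℕ) → Integral X → Integral X
weighted μ I = record
  { ∫ = λ f → ∫ I (λ x → μ x * f x)
  ; isLinear = record
    { mono = λ h → mono λ x → *-monoʳ-≤ (μ x) (h x)
    ; add = λ f g → trans (ext λ x → *-distribˡ-+ (μ x) (f x) (g x)) (add _ _)
    ; scale = λ c f → trans (ext λ x → *-left-comm (μ x) c (f x)) (scale c _) }
  ; fubini = λ J f → trans (ext λ x → sym (Linear.scale J (μ x) (f x))) (fubini J _) }
  where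
  open Integral I hiding (∫)

infixr 5 _⊗_
_⊗_ : Integral X → Integral Y → Integral (X × Y)
I ⊗ J = record
  { ∫ = λ f → ∫ I (λ x → ∫ J (λ y → f (x , y)))
  ; isLinear = record
    { mono = λ h → I.mono λ x → J.mono λ y → h (x , y)
    ; add = λ f g → trans (I.ext λ x → J.add _ _) (I.add _ _)
    ; scale = λ c f → trans (I.ext λ x → J.scale c _) (I.scale c _) }
  ; fubini = λ K f → trans (I.ext λ x → J.fubini K _) (I.fubini K _) }
  where
  module I = Integral I
  module J = Integral J

vectors : Integral X → ∀ l → Integral (Vec X l)
vectors I zero = record
  { ∫ = λ f → f []
  ; isLinear = record { mono = λ h → h [] ; add = λ _ _ → refl ; scale = λ _ _ → refl }
  ; fubini = λ _ _ → refl }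
vectors I (suc l) = record
  { ∫ = λ f → ∫ I (λ x → ∫ J (λ v → f (x ∷ v)))
  ; isLinear = record
    { mono = λ h → I.mono λ x → J.mono λ v → h (x ∷ v)
    ; add = λ f g → trans (I.ext λ x → J.add _ _) (I.add _ _)
    ; scale = λ c f → trans (I.ext λ x → J.scale c _) (I.scale c _) }
  ; fubini = λ K f → trans (I.ext λ x → J.fubini K _) (I.fubini K _) }
  where
  J = vectors I l
  module I = Integral I
  module J = Integral J

vectors-++ : (I : Integral X) → ∀ i j (f : Vec X (i + suc j) → ℕ) →
  ∫ (vectors I (i + suc j)) f ≡
  ∫ (vectors I i) (λ u → ∫ I (λ y → ∫ (vectors I j) (λ v → f (u ++ y ∷ v))))
vectors-++ I zero    j f = refl
vectors-++ I (suc i) j f = Integral.ext I λ x → vectors-++ I i j (λ w → f (x ∷ w))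

-- One coordinate is carried past all others by repeated `swap`; this is what makes rotation of
-- closed walks measure preserving.
vectors-∷ʳ : (I : Integral X) → ∀ l (f : Vec X (suc l) → ℕ) →
  ∫ (vectors I (suc l)) f ≡ ∫ I (λ x → ∫ (vectors I l) (λ v → f (v ∷ʳ x)))
vectors-∷ʳ I zero    f = refl
vectors-∷ʳ I (suc l) f =
  trans (Integral.ext I λ y → vectors-∷ʳ I l (λ w → f (y ∷ w))) (swap I I _)

∫∫-product : (I : Integral X) (J : Integral Y) (f : X → ℕ) (g : Y → ℕ) →
  ∫ I (λ x → ∫ J (λ y → f x * g y)) ≡ ∫ I f * ∫ J g
∫∫-product I J f g =
  trans (Integral.ext I λ x → Integral.scale J (f x) g) (Integral.scaleʳ I (∫ J g) f)

am-gm : ∀ a b → a * b + a * b ≤ a * a + b * b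
am-gm a b with ≤-total a b
... | inj₁ a≤b with m≤n⇒∃[o]m+o≡n a≤b
...   | c , refl = subst (a * (a + c) + a * (a + c) ≤_) (sym (square a c)) (m≤m+n _ _)
  where
  square : ∀ a c → a * a + (a + c) * (a + c) ≡ (a * (a + c) + a * (a + c)) + c * c
  square = solve-∀
am-gm a b | inj₂ b≤a with m≤n⇒∃[o]m+o≡n b≤a
...   | c , refl = subst ((b + c) * b + (b + c) * b ≤_) (sym (square b c)) (m≤m+n _ _)
  where
  square : ∀ b c → (b + c) * (b + c) + b * b ≡ ((b + c) * b + (b + c) * b) + c * c
  square = solve-∀

double-cancel : ∀ a b → a + a ≤ b + b → a ≤ b
double-cancel a b h = *-cancelˡ-≤ 2 (subst₂ _≤_ (double a) (double b) h)
  where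
  double : ∀ a → a + a ≡ 2 * a
  double = solve-∀

-- Integrate 2 ab ≤ a² + b² with a = f(x) g(y) and b = g(x) f(y).
cauchy-schwarz : (I : Integral X) (f g : X → ℕ) →
  ∫ I (λ x → f x * g x) * ∫ I (λ x → f x * g x) ≤
  ∫ I (λ x → f x * f x) * ∫ I (λ x → g x * g x)
cauchy-schwarz I f g = double-cancel _ _ (begin
  fg * fg + fg * fg
    ≡⟨ cong₂ _+_ (∫∫-product I I _ _) (∫∫-product I I _ _) ⟨
  ∫ II (λ (x , y) → (f x * g x) * (f y * g y)) + ∫ II (λ (x , y) → (f x * g x) * (f y * g y))
    ≡⟨ add _ _ ⟨
  ∫ II (λ (x , y) → (f x * g x) * (f y * g y) + (f x * g x) * (f y * g y))
    ≤⟨ mono (λ (x , y) → pointwise (f x) (g x) (f y) (g y)) ⟩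
  ∫ II (λ (x , y) → (f x * f x) * (g y * g y) + (g x * g x) * (f y * f y))
    ≡⟨ add _ _ ⟩
  ∫ II (λ (x , y) → (f x * f x) * (g y * g y)) + ∫ II (λ (x , y) → (g x * g x) * (f y * f y))
    ≡⟨ cong₂ _+_ (∫∫-product I I _ _) (∫∫-product I I _ _) ⟩
  ff * gg + gg * ff
    ≡⟨ cong (ff * gg +_) (*-comm gg ff) ⟩
  ff * gg + ff * gg ∎)
  where
  open ≤-Reasoning
  II = I ⊗ I
  open Integral II using (add; mono)
  fg = ∫ I (λ x → f x * g x)
  ff = ∫ I (λ x → f x * f x)
  gg = ∫ I (λ x → g x * g x)
  lhs : ∀ a b c d → (a * d) * (b * c) + (a * d) * (b * c) ≡ (a * b) * (c * d) + (a * b) * (c * d)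
  lhs = solve-∀
  rhs : ∀ a b c d → (a * d) * (a * d) + (b * c) * (b * c) ≡ (a * a) * (d * d) + (b * b) * (c * c)
  rhs = solve-∀
  pointwise : ∀ a b c d → (a * b) * (c * d) + (a * b) * (c * d) ≤ (a * a) * (d * d) + (b * b) * (c * c)
  pointwise a b c d = begin
    (a * b) * (c * d) + (a * b) * (c * d) ≡⟨ lhs a b c d ⟨
    (a * d) * (b * c) + (a * d) * (b * c) ≤⟨ am-gm (a * d) (b * c) ⟩
    (a * d) * (a * d) + (b * c) * (b * c) ≡⟨ rhs a b c d ⟩
    (a * a) * (d * d) + (b * b) * (c * c) ∎

term≤sumFin : ∀ n (f : Fin n → ℕ) x → f x ≤ sumFin n f
term≤sumFin (suc n) f zero    = m≤m+n _ _
term≤sumFin (suc n) f (suc x) = ≤-trans (term≤sumFin n _ x) (m≤n+m _ _)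

sumFin-const : ∀ n c → sumFin n (λ _ → c) ≡ n * c
sumFin-const zero    c = refl
sumFin-const (suc n) c = cong (c +_) (sumFin-const n c)

^-distribʳ-* : ∀ x y k → (x * y) ^ k ≡ x ^ k * y ^ k
^-distribʳ-* x y zero    = refl
^-distribʳ-* x y (suc k) = trans (cong (x * y *_) (^-distribʳ-* x y k)) (*-interchange x y (x ^ k) (y ^ k))

-- Log-convex sequences

module LogConvex (a : ℕ → ℕ) (log-convex : ∀ j → a (1 + j) * a (1 + j) ≤ a j * a (2 + j)) where

  -- Division by `z`, with the case of zero left to the caller, since terms of the sequence may
  -- vanish.
  cancel-factor : ∀ x y z → z * x ≤ z * y → (z ≡ 0 → x ≤ y) → x ≤ y
  cancel-factor x y zero    h h₀ = h₀ refl
  cancel-factor x y (suc z) h h₀ = *-cancelˡ-≤ (suc z) h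

  -- Log-convexity says that quotients of consecutive terms never decrease, so the lower bound
  -- `q / p` on the first one persists.
  ratio : ∀ q p → q * a 0 ≤ p * a 1 → ∀ j → q * a j ≤ p * a (1 + j)
  ratio q p h zero    = h
  ratio q p h (suc j) = cancel-factor _ _ (a (1 + j)) (begin
    a (1 + j) * (q * a (1 + j)) ≡⟨ *-left-comm (a (1 + j)) q (a (1 + j)) ⟩
    q * (a (1 + j) * a (1 + j)) ≤⟨ *-monoʳ-≤ q (log-convex j) ⟩
    q * (a j * a (2 + j))       ≡⟨ *-assoc q (a j) (a (2 + j)) ⟨
    (q * a j) * a (2 + j)       ≤⟨ *-monoˡ-≤ (a (2 + j)) (ratio q p h j) ⟩
    (p * a (1 + j)) * a (2 + j) ≡⟨ *-pull p (a (1 + j)) (a (2 + j)) ⟩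
    a (1 + j) * (p * a (2 + j)) ∎)
    (λ a≡0 → subst (_≤ p * a (2 + j)) (sym (trans (cong (q *_) a≡0) (*-zeroʳ q))) z≤n)
    where open ≤-Reasoning

  geometric : ∀ q p → q * a 0 ≤ p * a 1 → ∀ j → q ^ j * a 0 ≤ p ^ j * a j
  geometric q p h zero    = ≤-refl
  geometric q p h (suc j) = begin
    (q * q ^ j) * a 0       ≡⟨ *-assoc q (q ^ j) (a 0) ⟩
    q * (q ^ j * a 0)       ≤⟨ *-monoʳ-≤ q (geometric q p h j) ⟩
    q * (p ^ j * a j)       ≡⟨ *-left-comm q (p ^ j) (a j) ⟩
    p ^ j * (q * a j)       ≤⟨ *-monoʳ-≤ (p ^ j) (ratio q p h j) ⟩
    p ^ j * (p * a (1 + j)) ≡⟨ *-pull p (p ^ j) (a (1 + j)) ⟨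
    (p * p ^ j) * a (1 + j) ∎
    where open ≤-Reasoning

  -- This is log-convexity at the indices -1, `j` and `j + 1`, with `n` standing in for a term at
  -- -1.
  interpolate : ∀ n → a 0 ^ 2 ≤ n * a 1 ^ 1 → ∀ j → a j ^ (2 + j) ≤ n * a (1 + j) ^ (1 + j)
  interpolate n h zero    = h
  interpolate n h (suc j) = cancel-factor _ _ (b ^ (1 + j)) (begin
    b ^ (1 + j) * b ^ (3 + j)               ≡⟨ regroup b (b ^ j) ⟩
    b ^ (2 + j) * b ^ (2 + j)               ≡⟨ ^-distribʳ-* b b (2 + j) ⟨
    (b * b) ^ (2 + j)                       ≤⟨ ^-monoˡ-≤ (2 + j) (log-convex j) ⟩
    (a j * c) ^ (2 + j)                     ≡⟨ ^-distribʳ-* (a j) c (2 + j) ⟩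
    a j ^ (2 + j) * c ^ (2 + j)             ≤⟨ *-monoˡ-≤ (c ^ (2 + j)) (interpolate n h j) ⟩
    (n * b ^ (1 + j)) * c ^ (2 + j)         ≡⟨ *-pull n (b ^ (1 + j)) (c ^ (2 + j)) ⟩
    b ^ (1 + j) * (n * c ^ (2 + j))         ∎)
    (λ b^≡0 → subst (λ z → z ^ (3 + j) ≤ n * c ^ (2 + j)) (sym (m^n≡0⇒m≡0 b (1 + j) b^≡0)) z≤n)
    where
    open ≤-Reasoning
    b = a (1 + j)
    c = a (2 + j)
    regroup : ∀ b x → (b * x) * (b * (b * (b * x))) ≡ (b * (b * x)) * (b * (b * x))
    regroup = solve-∀

-- Powers of a symmetric kernel, their energies and closed walks

module Kernel {V : Set} (I : Integral V) (A : V → V → ℕ) (A-sym : ∀ x y → A x y ≡ A y x) where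
  open Integral I hiding (∫)
  open ≡-Reasoning

  op : (V → ℕ) → V → ℕ
  op u x = ∫ I (λ y → A x y * u y)

  iter : ℕ → (V → ℕ) → V → ℕ
  iter zero    u = u
  iter (suc j) u = op (iter j u)

  -- The kernel of the (j+1)-st power of op.
  pow : ℕ → V → V → ℕ
  pow j x y = iter j (λ z → A z y) x

  op-self-adjoint : ∀ u v → ∫ I (λ x → op u x * v x) ≡ ∫ I (λ x → u x * op v x)
  op-self-adjoint u v = begin
    ∫ I (λ x → op u x * v x)                     ≡⟨ ext (λ x → scaleʳ (v x) _) ⟨
    ∫ I (λ x → ∫ I (λ y → (A x y * u y) * v x))  ≡⟨ swap I I _ ⟩
    ∫ I (λ y → ∫ I (λ x → (A x y * u y) * v x))  ≡⟨ ext (λ y → ext λ x → regroup x y) ⟩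
    ∫ I (λ y → ∫ I (λ x → u y * (A y x * v x)))  ≡⟨ ext (λ y → scale (u y) _) ⟩
    ∫ I (λ y → u y * op v y)                     ∎
    where
    regroup : ∀ x y → (A x y * u y) * v x ≡ u y * (A y x * v x)
    regroup x y = trans (*-pull (A x y) (u y) (v x)) (cong (λ z → u y * (z * v x)) (A-sym x y))

  iter-pow : ∀ j u x → iter (suc j) u x ≡ ∫ I (λ y → pow j x y * u y)
  iter-pow zero    u x = refl
  iter-pow (suc j) u x = begin
    ∫ I (λ z → A x z * iter (suc j) u z)                ≡⟨ ext (λ z → cong (A x z *_) (iter-pow j u z)) ⟩
    ∫ I (λ z → A x z * ∫ I (λ y → pow j z y * u y))     ≡⟨ ext (λ z → scale (A x z) _) ⟨
    ∫ I (λ z → ∫ I (λ y → A x z * (pow j z y * u y)))   ≡⟨ swap I I _ ⟩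
    ∫ I (λ y → ∫ I (λ z → A x z * (pow j z y * u y)))   ≡⟨ ext (λ y → ext λ z → *-assoc (A x z) (pow j z y) (u y)) ⟨
    ∫ I (λ y → ∫ I (λ z → (A x z * pow j z y) * u y))   ≡⟨ ext (λ y → scaleʳ (u y) _) ⟩
    ∫ I (λ y → pow (suc j) x y * u y)                   ∎

  pow-sym : ∀ j x y → pow j x y ≡ pow j y x
  pow-sym zero    x y = A-sym x y
  pow-sym (suc j) x y = begin
    pow (suc j) x y                     ≡⟨ iter-pow j (λ z → A z y) x ⟩
    ∫ I (λ z → pow j x z * A z y)       ≡⟨ ext (λ z → trans (cong₂ _*_ (pow-sym j x z) (A-sym z y)) (*-comm (pow j z x) (A y z))) ⟩
    pow (suc j) y x                     ∎

  -- A squared norm summed over a family of vectors: over `trivial` it concerns one vector, over the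
  -- columns of `A` it is the trace of an even power of `op`.
  energy : Integral Y → (Y → V → ℕ) → ℕ → ℕ
  energy J u j = ∫ J (λ y → ∫ I (λ x → iter j (u y) x * iter j (u y) x))

  -- Self-adjointness turns the squared norm of the middle iterate into an inner product of its two
  -- neighbours, to which Cauchy-Schwarz applies.
  energy-log-convex : (J : Integral Y) (u : Y → V → ℕ) → ∀ j →
    energy J u (1 + j) * energy J u (1 + j) ≤ energy J u j * energy J u (2 + j)
  energy-log-convex J u j = subst (λ e → e * e ≤ energy J u j * energy J u (2 + j)) (sym middle)
    (cauchy-schwarz (J ⊗ I) (λ (y , x) → iter j (u y) x) (λ (y , x) → iter (2 + j) (u y) x))
    where
    middle : energy J u (1 + j) ≡ ∫ J (λ y → ∫ I (λ x → iter j (u y) x * iter (2 + j) (u y) x))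
    middle = Integral.ext J λ y → op-self-adjoint (iter j (u y)) (iter (1 + j) (u y))

  -- The total weight of the closed walks of length 2 (j + 1).
  moment : ℕ → ℕ
  moment = energy I (λ y z → A z y)

  -- The operator norm of a power of `op` is at most its Hilbert-Schmidt norm, whose square is
  -- `moment j`.
  energy-bound : ∀ j u →
    energy trivial (λ _ → u) (1 + j) ≤ moment j * energy trivial (λ _ → u) 0
  energy-bound j u = ≤-trans (mono bound) (≤-reflexive (trans (scaleʳ _ _) (cong (_* ∫ I (λ y → u y * u y)) (swap I I _))))
    where
    bound : ∀ x → iter (1 + j) u x * iter (1 + j) u x ≤ ∫ I (λ y → pow j x y * pow j x y) * ∫ I (λ y → u y * u y)
    bound x = subst (λ e → e * e ≤ ∫ I (λ y → pow j x y * pow j x y) * ∫ I (λ y → u y * u y)) (sym (iter-pow j u x)) (cauchy-schwarz I (pow j x) u)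

  path : ∀ {l} → V → Vec V l → V → ℕ
  path x []      z = A x z
  path x (y ∷ v) z = A x y * path y v z

  path-++ : ∀ {i j} x (u : Vec V i) y (v : Vec V j) z →
    path x (u ++ y ∷ v) z ≡ path x u y * path y v z
  path-++ x []      y v z = refl
  path-++ x (w ∷ u) y v z =
    trans (cong (A x w *_) (path-++ w u y v z)) (sym (*-assoc (A x w) (path w u y) (path y v z)))

  ∫-path : ∀ j x y → ∫ (vectors I j) (λ v → path x v y) ≡ pow j x y
  ∫-path zero    x y = refl
  ∫-path (suc j) x y = ext λ z →
    trans (Integral.scale (vectors I j) (A x z) _) (cong (A x z *_) (∫-path j z y))

  -- Edge factors only; the vertex weights come from `I` upon integration.
  cycleWeight : ∀ {l} → Vec V (suc l) → ℕ
  cycleWeight (x ∷ v) = path x v x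

  path-∷ʳ : ∀ {l} x (v : Vec V l) y z → path x (v ∷ʳ y) z ≡ path x v y * A y z
  path-∷ʳ x []      y z = refl
  path-∷ʳ x (w ∷ v) y z =
    trans (cong (A x w *_) (path-∷ʳ w v y z)) (sym (*-assoc (A x w) (path w v y) (A y z)))

  -- Cutting at the start and at the opposite vertex `y` leaves two independent walks of `j + 1`
  -- steps with the same ends.
  ∫-cycleWeight : ∀ j → ∫ (vectors I (suc (j + suc j))) cycleWeight ≡ moment j
  ∫-cycleWeight j = begin
    ∫ I (λ x → ∫ (vectors I (j + suc j)) (λ v → path x v x))
      ≡⟨ ext (λ x → vectors-++ I j j _) ⟩
    ∫ I (λ x → ∫ (vectors I j) (λ u → ∫ I (λ y → ∫ (vectors I j) (λ v → path x (u ++ y ∷ v) x))))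
      ≡⟨ ext (λ x → swap (vectors I j) I _) ⟩
    ∫ I (λ x → ∫ I (λ y → ∫ (vectors I j) (λ u → ∫ (vectors I j) (λ v → path x (u ++ y ∷ v) x))))
      ≡⟨ ext (λ x → ext λ y → split x y) ⟩
    ∫ I (λ x → ∫ I (λ y → pow j y x * pow j y x)) ∎
    where
    split : ∀ x y → ∫ (vectors I j) (λ u → ∫ (vectors I j) (λ v → path x (u ++ y ∷ v) x)) ≡ pow j y x * pow j y x
    split x y = begin
      ∫ (vectors I j) (λ u → ∫ (vectors I j) (λ v → path x (u ++ y ∷ v) x))
        ≡⟨ Integral.ext (vectors I j) (λ u → Integral.ext (vectors I j) λ v → path-++ x u y v x) ⟩
      ∫ (vectors I j) (λ u → ∫ (vectors I j) (λ v → path x u y * path y v x))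
        ≡⟨ ∫∫-product (vectors I j) (vectors I j) _ _ ⟩
      ∫ (vectors I j) (λ u → path x u y) * ∫ (vectors I j) (λ v → path y v x)
        ≡⟨ cong₂ _*_ (trans (∫-path j x y) (pow-sym j x y)) (∫-path j y x) ⟩
      pow j y x * pow j y x ∎

-- Moment estimates for a graph with vertex weights

module WeightedGraph (n : ℕ) (A : Fin n → Fin n → ℕ) (A-sym : ∀ x y → A x y ≡ A y x)
  (A≤1 : ∀ x y → A x y ≤ 1) (μ : Fin n → ℕ) where

  V = Fin n
  C = counting n
  I = weighted μ C
  open Kernel I A A-sym public
  open Integral C hiding (∫)
  module I = Integral I

  degree : V → ℕ
  degree x = ∫ C (A x)

  A*A≡A : ∀ x y → A x y * A x y ≡ A x y
  A*A≡A x y with A x y | A≤1 x y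
  ... | 0 | _ = refl
  ... | 1 | _ = refl
  ... | suc (suc _) | s≤s ()

  -- The trace of the square of `op` is a sum of `n` diagonal entries. Cauchy-Schwarz bounds it by
  -- their squares, and adding the squares of the off-diagonal entries gives the trace of the fourth
  -- power.
  moment-0-1 : moment 0 ^ 2 ≤ n * moment 1 ^ 1
  moment-0-1 = subst₂ _≤_ lhs rhs (≤-trans (cauchy-schwarz C (λ _ → 1) (λ x → μ x * pow 1 x x)) (*-monoʳ-≤ (∫ C (λ _ → 1 * 1)) (mono diagonal)))
    where
    lhs : ∫ C (λ x → 1 * (μ x * pow 1 x x)) * ∫ C (λ x → 1 * (μ x * pow 1 x x)) ≡ moment 0 ^ 2
    lhs = trans (cong (λ z → z * z) (ext λ x → trans (*-identityˡ _) (cong (μ x *_) (I.ext λ y → cong (_* A y x) (A-sym x y)))))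
      (cong (moment 0 *_) (sym (*-identityʳ (moment 0))))
    rhs : ∫ C (λ _ → 1 * 1) * moment 1 ≡ n * moment 1 ^ 1
    rhs = cong₂ _*_ (trans (sumFin-const n 1) (*-identityʳ n)) (sym (*-identityʳ (moment 1)))
    exchange : ∀ a b → (a * b) * (a * b) ≡ a * (a * (b * b))
    exchange = solve-∀
    diagonal : ∀ x → (μ x * pow 1 x x) * (μ x * pow 1 x x) ≤ μ x * ∫ I (λ y → pow 1 y x * pow 1 y x)
    diagonal x = ≤-trans (≤-reflexive (exchange (μ x) (pow 1 x x)))
      (*-monoʳ-≤ (μ x) (term≤sumFin n (λ y → μ y * (pow 1 y x * pow 1 y x)) x))

  moment-interpolate : ∀ j → moment j ^ (2 + j) ≤ n * moment (1 + j) ^ (1 + j)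
  moment-interpolate = interpolate n moment-0-1
    where open LogConvex moment (energy-log-convex I _)

  module BadMass {i p s M K : ℕ} (β : V → V → Vec V i → V → ℕ) (β≤1 : ∀ x₀ x₁ u y → β x₀ x₁ u y ≤ 1)
    (∑β≤s : ∀ x₁ u y → ∫ C (λ x₀ → β x₀ x₁ u y) ≤ s)
    (μ-bound : ∀ x → M * μ x ≤ K) (degree-bound : ∀ x → n * (μ x * degree x) ≤ K) where

    open ≤-Reasoning
    module W = Integral (vectors I i)

    badPow : V → V → V → ℕ
    badPow x₀ x₁ y = ∫ (vectors I i) (λ u → path x₁ u y * β x₀ x₁ u y)

    badMass : ℕ
    badMass = ∫ I (λ x₀ → ∫ I (λ x₁ → ∫ I (λ y → A x₀ x₁ * (badPow x₀ x₁ y * pow p y x₀))))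

    CCI = C ⊗ C ⊗ I

    -- The two sides for Cauchy-Schwarz. The weights of `x₀` and `x₁` leave the measure: `F` takes
    -- that of `x₁` and `H` that of `x₀`, while the idempotent `A x₀ x₁` goes to both.
    F H : V × V × V → ℕ
    F (x₀ , x₁ , y) = A x₀ x₁ * (μ x₁ * badPow x₀ x₁ y)
    H (x₀ , x₁ , y) = A x₀ x₁ * (μ x₀ * pow p y x₀)

    badMass-FH : badMass ≡ ∫ CCI (λ z → F z * H z)
    badMass-FH = ext λ x₀ → trans (sym (scale (μ x₀) _)) (ext λ x₁ →
      trans (sym (*-assoc (μ x₀) (μ x₁) _)) (trans (sym (I.scale (μ x₀ * μ x₁) _)) (I.ext λ y →
      trans (cong (λ a → μ x₀ * μ x₁ * (a * (badPow x₀ x₁ y * pow p y x₀))) (sym (A*A≡A x₀ x₁)))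
        (regroup (μ x₀) (μ x₁) (A x₀ x₁) (badPow x₀ x₁ y) (pow p y x₀)))))
      where
      regroup : ∀ a b c f g → (a * b) * ((c * c) * (f * g)) ≡ (c * (b * f)) * (c * (a * g))
      regroup = solve-∀

    badPow≤pow : ∀ x₀ x₁ y → badPow x₀ x₁ y ≤ pow i x₁ y
    badPow≤pow x₀ x₁ y = ≤-trans (W.mono λ u → ≤-trans (*-monoʳ-≤ (path x₁ u y) (β≤1 x₀ x₁ u y)) (≤-reflexive (*-identityʳ _)))
      (≤-reflexive (∫-path i x₁ y))

    ∑badPow≤ : ∀ x₁ y → ∫ C (λ x₀ → badPow x₀ x₁ y) ≤ s * pow i x₁ y
    ∑badPow≤ x₁ y = begin
      ∫ C (λ x₀ → badPow x₀ x₁ y)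
        ≡⟨ swap C (vectors I i) _ ⟩
      ∫ (vectors I i) (λ u → ∫ C (λ x₀ → path x₁ u y * β x₀ x₁ u y))
        ≡⟨ W.ext (λ u → scale (path x₁ u y) _) ⟩
      ∫ (vectors I i) (λ u → path x₁ u y * ∫ C (λ x₀ → β x₀ x₁ u y))
        ≤⟨ W.mono (λ u → *-monoʳ-≤ (path x₁ u y) (∑β≤s x₁ u y)) ⟩
      ∫ (vectors I i) (λ u → path x₁ u y * s)
        ≡⟨ W.scaleʳ s _ ⟩
      ∫ (vectors I i) (λ u → path x₁ u y) * s
        ≡⟨ trans (cong (_* s) (∫-path i x₁ y)) (*-comm _ s) ⟩
      s * pow i x₁ y ∎

    -- One of the two factors `badPow` is relaxed to `pow`, which is free of `x₀`; the other is
    -- kept, and its sum over `x₀` costs only `s`.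
    ∑F²≤ : ∀ x₁ y → ∫ C (λ x₀ → F (x₀ , x₁ , y) * F (x₀ , x₁ , y)) ≤
                    μ x₁ * (μ x₁ * (s * (pow i x₁ y * pow i x₁ y)))
    ∑F²≤ x₁ y = begin
      ∫ C (λ x₀ → F (x₀ , x₁ , y) * F (x₀ , x₁ , y))
        ≤⟨ mono (λ x₀ → *-mono-≤ (drop-A x₀ (μ x₁ * pow i x₁ y) (*-monoʳ-≤ (μ x₁) (badPow≤pow x₀ x₁ y))) (drop-A x₀ (μ x₁ * badPow x₀ x₁ y) ≤-refl)) ⟩
      ∫ C (λ x₀ → (μ x₁ * pow i x₁ y) * (μ x₁ * badPow x₀ x₁ y))
        ≡⟨ trans (scale (μ x₁ * pow i x₁ y) _) (cong (μ x₁ * pow i x₁ y *_) (scale (μ x₁) _)) ⟩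
      (μ x₁ * pow i x₁ y) * (μ x₁ * ∫ C (λ x₀ → badPow x₀ x₁ y))
        ≤⟨ *-monoʳ-≤ (μ x₁ * pow i x₁ y) (*-monoʳ-≤ (μ x₁) (∑badPow≤ x₁ y)) ⟩
      (μ x₁ * pow i x₁ y) * (μ x₁ * (s * pow i x₁ y))
        ≡⟨ regroup (μ x₁) (pow i x₁ y) s ⟩
      μ x₁ * (μ x₁ * (s * (pow i x₁ y * pow i x₁ y))) ∎
      where
      regroup : ∀ a b c → (a * b) * (a * (c * b)) ≡ a * (a * (c * (b * b)))
      regroup = solve-∀
      drop-A : ∀ x₀ {a} b → a ≤ b → A x₀ x₁ * a ≤ b
      drop-A x₀ b a≤b = ≤-trans (*-mono-≤ (A≤1 x₀ x₁) a≤b) (≤-reflexive (*-identityˡ b))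

    -- One weight of `x₁` is traded for `K / M`; the other restores the measure `I`, and a trace
    -- appears.
    F²-bound : M * ∫ CCI (λ z → F z * F z) ≤ K * (s * moment i)
    F²-bound = begin
      M * ∫ CCI (λ z → F z * F z)
        ≡⟨ cong (M *_) (trans (swap C C _) (ext λ x₁ → swap C I _)) ⟩
      M * ∫ C (λ x₁ → ∫ I (λ y → ∫ C (λ x₀ → F (x₀ , x₁ , y) * F (x₀ , x₁ , y))))
        ≤⟨ *-monoʳ-≤ M (mono λ x₁ → I.mono λ y → ∑F²≤ x₁ y) ⟩
      M * ∫ C (λ x₁ → ∫ I (λ y → μ x₁ * (μ x₁ * (s * (pow i x₁ y * pow i x₁ y)))))
        ≡⟨ cong (M *_) (ext λ x₁ → trans (I.scale (μ x₁) _) (cong (μ x₁ *_) (I.scale (μ x₁) _))) ⟩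
      M * ∫ C (λ x₁ → μ x₁ * (μ x₁ * ∫ I (λ y → s * (pow i x₁ y * pow i x₁ y))))
        ≡⟨ scale M _ ⟨
      ∫ C (λ x₁ → M * (μ x₁ * (μ x₁ * ∫ I (λ y → s * (pow i x₁ y * pow i x₁ y)))))
        ≤⟨ mono (λ x₁ → ≤-trans (≤-reflexive (sym (*-assoc M (μ x₁) _))) (*-monoˡ-≤ _ (μ-bound x₁))) ⟩
      ∫ C (λ x₁ → K * (μ x₁ * ∫ I (λ y → s * (pow i x₁ y * pow i x₁ y))))
        ≡⟨ scale K _ ⟩
      K * ∫ I (λ x₁ → ∫ I (λ y → s * (pow i x₁ y * pow i x₁ y)))
        ≡⟨ cong (K *_) (trans (Integral.scale (I ⊗ I) s _) (cong (s *_) (swap I I _))) ⟩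
      K * (s * moment i) ∎

    -- Here `x₁` occurs only in `A x₀ x₁`, so its sum is the degree of `x₀`, which `degree-bound`
    -- absorbs together with one weight of `x₀`.
    H²-bound : n * ∫ CCI (λ z → H z * H z) ≤ K * moment p
    H²-bound = begin
      n * ∫ CCI (λ z → H z * H z)
        ≡⟨ scale n _ ⟨
      ∫ C (λ x₀ → n * ∫ C (λ x₁ → ∫ I (λ y → H (x₀ , x₁ , y) * H (x₀ , x₁ , y))))
        ≡⟨ ext (λ x₀ → cong (n *_) (∑H² x₀)) ⟩
      ∫ C (λ x₀ → n * (degree x₀ * (μ x₀ * (μ x₀ * ∫ I (λ y → pow p y x₀ * pow p y x₀)))))
        ≡⟨ ext (λ x₀ → regroup n (degree x₀) (μ x₀) _) ⟩
      ∫ C (λ x₀ → n * (μ x₀ * degree x₀) * (μ x₀ * ∫ I (λ y → pow p y x₀ * pow p y x₀)))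
        ≤⟨ mono (λ x₀ → *-monoˡ-≤ _ (degree-bound x₀)) ⟩
      ∫ C (λ x₀ → K * (μ x₀ * ∫ I (λ y → pow p y x₀ * pow p y x₀)))
        ≡⟨ scale K _ ⟩
      K * moment p ∎
      where
      regroup : ∀ a b c d → a * (b * (c * (c * d))) ≡ (a * (c * b)) * (c * d)
      regroup = solve-∀
      regroup′ : ∀ a b c → (a * (b * c)) * (a * (b * c)) ≡ (a * a) * (b * (b * (c * c)))
      regroup′ = solve-∀
      ∑H² : ∀ x₀ → ∫ C (λ x₁ → ∫ I (λ y → H (x₀ , x₁ , y) * H (x₀ , x₁ , y))) ≡
                     degree x₀ * (μ x₀ * (μ x₀ * ∫ I (λ y → pow p y x₀ * pow p y x₀)))
      ∑H² x₀ = trans (ext λ x₁ → trans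
        (I.ext λ y → trans (regroup′ (A x₀ x₁) (μ x₀) (pow p y x₀)) (cong (_* (μ x₀ * (μ x₀ * (pow p y x₀ * pow p y x₀)))) (A*A≡A x₀ x₁)))
        (trans (I.scale (A x₀ x₁) _) (cong (A x₀ x₁ *_) (trans (I.scale (μ x₀) _) (cong (μ x₀ *_) (I.scale (μ x₀) _))))))
        (scaleʳ _ _)

    badMass-bound : (M * n) * (badMass * badMass) ≤ (K * (s * moment i)) * (K * moment p)
    badMass-bound = begin
      (M * n) * (badMass * badMass)
        ≡⟨ cong (λ N → (M * n) * (N * N)) badMass-FH ⟩
      (M * n) * (∫ CCI (λ z → F z * H z) * ∫ CCI (λ z → F z * H z))
        ≤⟨ *-monoʳ-≤ (M * n) (cauchy-schwarz CCI F H) ⟩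
      (M * n) * (∫ CCI (λ z → F z * F z) * ∫ CCI (λ z → H z * H z))
        ≡⟨ *-interchange M n _ _ ⟩
      (M * ∫ CCI (λ z → F z * F z)) * (n * ∫ CCI (λ z → H z * H z))
        ≤⟨ *-mono-≤ F²-bound H²-bound ⟩
      (K * (s * moment i)) * (K * moment p) ∎

  module MomentLowerBound {M K : ℕ} .{{_ : NonZero n}} .{{_ : NonZero M}} .{{_ : NonZero K}}
    (μ-inverse : ∀ x → μ x * (n * degree x + M) ≡ K) (M≤∑degree : M ≤ ∫ C degree) where

    open ≤-Reasoning

    D : V → ℕ
    D x = n * degree x + M

    σ = ∫ C degree
    e = energy trivial (λ _ → D)
    open LogConvex e (energy-log-convex trivial (λ _ → D))

    e₀≡ : e 0 ≡ K * (n * σ + n * M)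
    e₀≡ = begin-equality
      ∫ C (λ x → μ x * (D x * D x)) ≡⟨ ext (λ x → trans (sym (*-assoc (μ x) (D x) (D x))) (cong (_* D x) (μ-inverse x))) ⟩
      ∫ C (λ x → K * D x)           ≡⟨ scale K D ⟩
      K * ∫ C D                     ≡⟨ cong (K *_) (trans (add _ _) (cong₂ _+_ (scale n degree) (sumFin-const n M))) ⟩
      K * (n * σ + n * M)           ∎

    -- The test vector `D` is chosen so that the weights cancel it to the constant `K`; hence `op D`
    -- is `K` times the degree.
    ⟨D,op-D⟩ : ∫ I (λ x → D x * op D x) ≡ K * (σ * K)
    ⟨D,op-D⟩ = begin-equality
      ∫ C (λ x → μ x * (D x * op D x))    ≡⟨ ext (λ x → trans (sym (*-assoc (μ x) (D x) _)) (cong₂ _*_ (μ-inverse x) (op-D x))) ⟩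
      ∫ C (λ x → K * (degree x * K))      ≡⟨ trans (scale K _) (cong (K *_) (scaleʳ K _)) ⟩
      K * (σ * K)                         ∎
      where
      op-D : ∀ x → op D x ≡ degree x * K
      op-D x = trans (ext λ y → trans (*-left-comm (μ y) (A x y) (D y)) (cong (A x y *_) (μ-inverse y))) (scaleʳ K _)

    -- As `M` is at most `σ`, `e 0` is at most `2 * K * n * σ`, so the Rayleigh quotient of `D` is
    -- at least `K / (2 n)`. Cauchy-Schwarz passes from its square to `e 1`.
    first-ratio : (K * K) * e 0 ≤ (4 * (n * n)) * e 1
    first-ratio = cancel-factor _ _ (e 0) (begin
      e 0 * (K * K * e 0)                         ≡⟨ regroup₁ (e 0) K ⟩
      K * K * (e 0 * e 0)                         ≤⟨ *-monoʳ-≤ (K * K) (*-mono-≤ e₀≤ e₀≤) ⟩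
      K * K * (K * (n * σ + n * σ) * (K * (n * σ + n * σ)))   ≡⟨ regroup₂ K n σ ⟩
      4 * (n * n) * (K * (σ * K) * (K * (σ * K))) ≡⟨ cong (λ z → 4 * (n * n) * (z * z)) ⟨D,op-D⟩ ⟨
      4 * (n * n) * (∫ I (λ x → D x * op D x) * ∫ I (λ x → D x * op D x))
                                                  ≤⟨ *-monoʳ-≤ (4 * (n * n)) (cauchy-schwarz I D (op D)) ⟩
      4 * (n * n) * (e 0 * e 1)                   ≡⟨ *-left-comm (4 * (n * n)) (e 0) (e 1) ⟩
      e 0 * (4 * (n * n) * e 1)                   ∎)
      (λ e₀≡0 → subst (_≤ 4 * (n * n) * e 1) (sym (trans (cong (K * K *_) e₀≡0) (*-zeroʳ (K * K)))) z≤n)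
      where
      e₀≤ : e 0 ≤ K * (n * σ + n * σ)
      e₀≤ = ≤-trans (≤-reflexive e₀≡) (*-monoʳ-≤ K (+-monoʳ-≤ (n * σ) (*-monoʳ-≤ n M≤∑degree)))
      regroup₁ : ∀ a b → a * (b * b * a) ≡ b * b * (a * a)
      regroup₁ = solve-∀
      regroup₂ : ∀ a b c → a * a * (a * (b * c + b * c) * (a * (b * c + b * c))) ≡ 4 * (b * b) * (a * (c * a) * (a * (c * a)))
      regroup₂ = solve-∀

    -- The energies of the iterates of `D` grow at least geometrically by `first-ratio`, yet by
    -- `energy-bound` at most by the factor `moment j`.
    moment-lower-bound : ∀ j → (K * K) ^ (1 + j) ≤ (4 * (n * n)) ^ (1 + j) * moment j
    moment-lower-bound j = *-cancelʳ-≤ _ _ (e 0) {{e₀≢0}} (begin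
      (K * K) ^ (1 + j) * e 0                           ≤⟨ geometric (K * K) (4 * (n * n)) first-ratio (1 + j) ⟩
      (4 * (n * n)) ^ (1 + j) * e (1 + j)               ≤⟨ *-monoʳ-≤ ((4 * (n * n)) ^ (1 + j)) (energy-bound j D) ⟩
      (4 * (n * n)) ^ (1 + j) * (moment j * e 0)        ≡⟨ *-assoc ((4 * (n * n)) ^ (1 + j)) (moment j) (e 0) ⟨
      (4 * (n * n)) ^ (1 + j) * moment j * e 0          ∎)
      where
      e₀≢0 : NonZero (e 0)
      e₀≢0 = subst NonZero (sym e₀≡) (m*n≢0 K (n * σ + n * M) {{it}} {{>-nonZero (≤-trans (>-nonZero⁻¹ (n * M) {{m*n≢0 n M}}) (m≤n+m _ (n * σ)))}})

-- Indicators and counting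

⟦_⟧ : Dec P → ℕ
⟦ true  because _ ⟧ = 1
⟦ false because _ ⟧ = 0

⟦⟧≤1 : (p : Dec P) → ⟦ p ⟧ ≤ 1
⟦⟧≤1 (yes _) = ≤-refl
⟦⟧≤1 (no _)  = z≤n

⟦⟧-true : (p : Dec P) → P → ⟦ p ⟧ ≡ 1
⟦⟧-true (yes _) _ = refl
⟦⟧-true (no ¬p) p = contradiction p ¬p

⟦⟧-false : (p : Dec P) → ¬ P → ⟦ p ⟧ ≡ 0
⟦⟧-false (yes p) ¬p = contradiction p ¬p
⟦⟧-false (no _)  _  = refl

⟦⟧-≤ : (p : Dec P) {c : ℕ} → (P → 1 ≤ c) → ⟦ p ⟧ ≤ c
⟦⟧-≤ (yes p) h = h p
⟦⟧-≤ (no _)  h = z≤n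

⟦⟧-mono : (p : Dec P) (q : Dec Q) → (P → Q) → ⟦ p ⟧ ≤ ⟦ q ⟧
⟦⟧-mono p q h = ⟦⟧-≤ p λ a → ≤-reflexive (sym (⟦⟧-true q (h a)))

⟦⟧-⊎ : (p : Dec P) (q : Dec Q) → ⟦ p ⊎-dec q ⟧ ≤ ⟦ p ⟧ + ⟦ q ⟧
⟦⟧-⊎ p q = ⟦⟧-≤ (p ⊎-dec q) λ
  { (inj₁ a) → ≤-trans (≤-reflexive (sym (⟦⟧-true p a))) (m≤m+n _ _)
  ; (inj₂ b) → ≤-trans (≤-reflexive (sym (⟦⟧-true q b))) (m≤n+m _ _) }

⟦⟧-∃ : ∀ {n} {R : Fin n → Set} (R? : ∀ z → Dec (R z)) → ⟦ any? R? ⟧ ≤ sumFin n (λ z → ⟦ R? z ⟧)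
⟦⟧-∃ {n} R? = ⟦⟧-≤ (any? R?) λ (z , a) →
  ≤-trans (≤-reflexive (sym (⟦⟧-true (R? z) a))) (term≤sumFin n (λ z → ⟦ R? z ⟧) z)

-- Turns a count into distinct witnesses: later, two vertices of an edge, or the inner vertices of a
-- cycle edge.
enumerate : ∀ {n} {R : Fin n → Set} (R? : ∀ z → Dec (R z)) c → c ≤ sumFin n (λ z → ⟦ R? z ⟧) →
  Σ (Fin c → Fin n) λ f → Injective _≡_ _≡_ f × (∀ q → R (f q))
enumerate {zero} R? zero    h = (λ ()) , (λ { {()} }) , λ ()
enumerate {zero} R? (suc c) ()
enumerate {suc n} R? c h with R? zero
enumerate {suc n} R? zero    h       | yes a = (λ ()) , (λ { {()} }) , λ ()
enumerate {suc n} {R} R? (suc c) (s≤s h) | yes a with enumerate (R? ∘ suc) c h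
... | f , f-inj , Rf = f′ , f′-inj , λ { zero → a ; (suc q) → Rf q }
  where
  f′ : Fin (suc c) → Fin (suc n)
  f′ zero    = zero
  f′ (suc q) = suc (f q)
  f′-inj : Injective _≡_ _≡_ f′
  f′-inj {zero}  {zero}  _  = refl
  f′-inj {suc _} {suc _} eq = cong suc (f-inj (suc-injective eq))
enumerate {suc n} R? c h | no _ with enumerate (R? ∘ suc) c h
... | f , f-inj , Rf = suc ∘ f , f-inj ∘ suc-injective , Rf

∑-unique≤1 : ∀ {n} {R : Fin n → Set} (R? : ∀ z → Dec (R z)) → (∀ {a b} → R a → R b → a ≡ b) →
  sumFin n (λ z → ⟦ R? z ⟧) ≤ 1
∑-unique≤1 {n} R? unique with sumFin n (λ z → ⟦ R? z ⟧) ≤? 1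
... | yes h = h
... | no h with enumerate R? 2 (≰⇒> h)
...   | f , f-inj , Rf with f-inj (unique (Rf zero) (Rf (suc zero)))
...     | ()

∑-unique≤∃ : ∀ {n} {R : Fin n → Set} (R? : ∀ z → Dec (R z)) (q : Dec Q) →
  (∀ {a b} → R a → R b → a ≡ b) → (∀ {a} → R a → Q) → sumFin n (λ z → ⟦ R? z ⟧) ≤ ⟦ q ⟧
∑-unique≤∃ R? (yes _) unique h = ∑-unique≤1 R? unique
∑-unique≤∃ {n = n} R? (no ¬q) unique h =
  ≤-reflexive (trans (Integral.ext (counting n) λ z → ⟦⟧-false (R? z) (¬q ∘ h)) (Integral.null (counting n)))

∈?-suc : ∀ {n} z (p : Subset n) {s} → ⟦ suc z ∈? (s ∷ p) ⟧ ≡ ⟦ z ∈? p ⟧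
∈?-suc z p with z ∈? p
... | yes _ = refl
... | no _  = refl

card-sum : ∀ {n} (p : Subset n) → sumFin n (λ z → ⟦ z ∈? p ⟧) ≡ ∣ p ∣
card-sum []          = refl
card-sum (true ∷ p)  = cong suc (trans (Integral.ext (counting _) λ z → ∈?-suc z p) (card-sum p))
card-sum (false ∷ p) = trans (Integral.ext (counting _) λ z → ∈?-suc z p) (card-sum p)

two≤card : ∀ {n} {p : Subset n} {a b} → a ≢ b → a ∈ p → b ∈ p → 2 ≤ ∣ p ∣
two≤card {n} {p} {a} {b} a≢b a∈p b∈p = ≤-trans (s≤s (begin
  1                 ≡⟨ ⟦⟧-true (b ∈? (p - a)) (x∈p∧x≢y⇒x∈p-y b∈p (a≢b ∘ sym)) ⟨
  ⟦ b ∈? (p - a) ⟧  ≤⟨ term≤sumFin n (λ z → ⟦ z ∈? (p - a) ⟧) b ⟩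
  _                 ≡⟨ card-sum (p - a) ⟩
  ∣ p - a ∣         ∎)) (x∈p⇒∣p-x∣<∣p∣ a∈p)
  where open ≤-Reasoning

-- Lines of a linear hypergraph and their intersections

module Lines {r n : ℕ} (G : LinearGraph r n) where

  V = Fin n
  C = counting n
  open Integral C hiding (∫)

  edge-unique : ∀ {a b e f} → a ≢ b → a ∈ edge G e → b ∈ edge G e → a ∈ edge G f → b ∈ edge G f → e ≡ f
  edge-unique {e = e} {f} a≢b a∈e b∈e a∈f b∈f with e ≟ᶠ f
  ... | yes e≡f = e≡f
  ... | no e≢f = contradiction (linear G e f e≢f)
    (<⇒≱ (two≤card a≢b (x∈p∩q⁺ (a∈e , a∈f)) (x∈p∩q⁺ (b∈e , b∈f))))

  -- Since `a ≢ b` is built in, linearity makes the edge unique. Taking `z = a` gives adjacency in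
  -- the shadow graph, whence `A`.
  InLine : V → V → V → Set
  InLine a b z = a ≢ b × ∃ λ e → a ∈ edge G e × b ∈ edge G e × z ∈ edge G e

  InLine? : ∀ a b z → Dec (InLine a b z)
  InLine? a b z = ¬? (a ≟ᶠ b) ×-dec any? λ e → (a ∈? edge G e) ×-dec ((b ∈? edge G e) ×-dec (z ∈? edge G e))

  A : V → V → ℕ
  A x y = ⟦ InLine? x y x ⟧

  A≤1 : ∀ x y → A x y ≤ 1
  A≤1 x y = ⟦⟧≤1 (InLine? x y x)

  A-sym : ∀ x y → A x y ≡ A y x
  A-sym x y = ≤-antisym (A-sym≤ x y) (A-sym≤ y x)
    where
    A-sym≤ : ∀ x y → A x y ≤ A y x
    A-sym≤ x y = ⟦⟧-mono (InLine? x y x) (InLine? y x y)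
      λ (x≢y , e , x∈e , y∈e , _) → x≢y ∘ sym , e , y∈e , x∈e , y∈e

  line-size : ∀ a b → ∫ C (λ z → ⟦ InLine? a b z ⟧) ≤ r
  line-size a b with any? (λ e → (a ∈? edge G e) ×-dec (b ∈? edge G e))
  ... | yes (e , a∈e , b∈e) = ≤-trans
    (mono λ z → ⟦⟧-mono (InLine? a b z) (z ∈? edge G e)
      λ (a≢b , f , a∈f , b∈f , z∈f) → subst (λ f → z ∈ edge G f) (edge-unique a≢b a∈f b∈f a∈e b∈e) z∈f)
    (≤-reflexive (trans (card-sum (edge G e)) (uniform G e)))
  ... | no ¬e = ≤-trans
    (≤-reflexive (trans (ext λ z → ⟦⟧-false (InLine? a b z) λ (_ , e , a∈e , b∈e , _) → ¬e (e , a∈e , b∈e)) null)) z≤n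

  -- Each edge has an ordered pair of distinct vertices because `r` is at least 2, and by linearity
  -- no pair serves two edges.
  m≤∑A : 2 ≤ r → m G ≤ ∫ C (λ x → ∫ C (A x))
  m≤∑A 2≤r = begin
    m G                                                         ≡⟨ trans (sumFin-const (m G) 1) (*-identityʳ (m G)) ⟨
    ∫ E (λ _ → 1)                                               ≤⟨ Integral.mono E pair ⟩
    ∫ E (λ e → ∫ C (λ x → ∫ C (λ y → ⟦ Pair? x y e ⟧)))         ≡⟨ trans (swap E C _) (ext λ x → swap E C _) ⟩
    ∫ C (λ x → ∫ C (λ y → ∫ E (λ e → ⟦ Pair? x y e ⟧)))         ≤⟨ mono (λ x → mono λ y → one-line x y) ⟩
    ∫ C (λ x → ∫ C (A x))                                       ∎
    where
    open ≤-Reasoning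
    E = counting (m G)
    Pair : V → V → Fin (m G) → Set
    Pair x y e = x ≢ y × x ∈ edge G e × y ∈ edge G e
    Pair? : ∀ x y e → Dec (Pair x y e)
    Pair? x y e = ¬? (x ≟ᶠ y) ×-dec ((x ∈? edge G e) ×-dec (y ∈? edge G e))
    one-line : ∀ x y → ∫ E (λ e → ⟦ Pair? x y e ⟧) ≤ A x y
    one-line x y = ∑-unique≤∃ (Pair? x y) (InLine? x y x)
      (λ (x≢y , x∈e , y∈e) (_ , x∈f , y∈f) → edge-unique x≢y x∈e y∈e x∈f y∈f)
      (λ {e} (x≢y , x∈e , y∈e) → x≢y , e , x∈e , y∈e , x∈e)
    pair : ∀ e → 1 ≤ ∫ C (λ x → ∫ C (λ y → ⟦ Pair? x y e ⟧))
    pair e with enumerate (λ z → z ∈? edge G e) 2 (subst (2 ≤_) (sym (trans (card-sum (edge G e)) (uniform G e))) 2≤r)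
    ... | f , f-inj , f∈e = ≤-trans (≤-reflexive (sym (⟦⟧-true (Pair? x y e) (x≢y , f∈e zero , f∈e (suc zero)))))
      (≤-trans (term≤sumFin n (λ y → ⟦ Pair? x y e ⟧) y) (term≤sumFin n (λ x → ∫ C (λ y → ⟦ Pair? x y e ⟧)) x))
      where
      x = f zero
      y = f (suc zero)
      x≢y : x ≢ y
      x≢y eq with f-inj eq
      ... | ()

  -- Discarding `x` and `y` loses at most two of the `r` vertices. The rest become the new vertices
  -- of a cycle edge.
  others : ∀ e x y → Σ (Fin (r ∸ 2) → V) λ f → Injective _≡_ _≡_ f × (∀ q → f q ∈ edge G e × f q ≢ x × f q ≢ y)
  others e x y = enumerate Other? (r ∸ 2) (m≤n+o⇒m∸n≤o r 2 (begin
    r                                                     ≡⟨ trans (card-sum (edge G e)) (uniform G e) ⟨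
    ∫ C (λ z → ⟦ z ∈? edge G e ⟧)                         ≤⟨ mono cover ⟩
    ∫ C (λ z → ⟦ z ≟ᶠ x ⟧ + (⟦ z ≟ᶠ y ⟧ + ⟦ Other? z ⟧))  ≡⟨ trans (add _ _) (cong (∫ C (λ z → ⟦ z ≟ᶠ x ⟧) +_) (add _ _)) ⟩
    ∫ C (λ z → ⟦ z ≟ᶠ x ⟧) + (∫ C (λ z → ⟦ z ≟ᶠ y ⟧) + ∫ C (λ z → ⟦ Other? z ⟧))
      ≤⟨ +-mono-≤ (single x) (+-monoˡ-≤ _ (single y)) ⟩
    2 + ∫ C (λ z → ⟦ Other? z ⟧)                          ∎))
    where
    open ≤-Reasoning
    Other? : ∀ z → Dec (z ∈ edge G e × z ≢ x × z ≢ y)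
    Other? z = (z ∈? edge G e) ×-dec (¬? (z ≟ᶠ x) ×-dec ¬? (z ≟ᶠ y))
    single : ∀ x → ∫ C (λ z → ⟦ z ≟ᶠ x ⟧) ≤ 1
    single x = ∑-unique≤1 (_≟ᶠ x) λ a≡x b≡x → trans a≡x (sym b≡x)
    cover : ∀ z → ⟦ z ∈? edge G e ⟧ ≤ ⟦ z ≟ᶠ x ⟧ + (⟦ z ≟ᶠ y ⟧ + ⟦ Other? z ⟧)
    cover z = ⟦⟧-≤ (z ∈? edge G e) λ z∈e → cases z∈e (z ≟ᶠ x) (z ≟ᶠ y) (Other? z)
      where
      cases : z ∈ edge G e → (p : Dec (z ≡ x)) (q : Dec (z ≡ y)) (o : Dec (z ∈ edge G e × z ≢ x × z ≢ y)) →
              1 ≤ ⟦ p ⟧ + (⟦ q ⟧ + ⟦ o ⟧)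
      cases z∈e (yes _) q o = s≤s z≤n
      cases z∈e (no _) (yes _) o = s≤s z≤n
      cases z∈e (no z≢x) (no z≢y) o = ≤-reflexive (sym (⟦⟧-true o (z∈e , z≢x , z≢y)))

  -- The vertex `b` is exempt because consecutive lines share it. Backtracking, or staying on the
  -- same edge, still counts as a hit, through `u = a`.
  Hit : V → V → V → V → Set
  Hit a b c d = ∃ λ u → u ≢ b × InLine a b u × InLine c d u

  HitAt? : ∀ a b c d u → Dec (u ≢ b × InLine a b u × InLine c d u)
  HitAt? a b c d u = ¬? (u ≟ᶠ b) ×-dec (InLine? a b u ×-dec InLine? c d u)

  Hit? : ∀ a b c d → Dec (Hit a b c d)
  Hit? a b c d = any? (HitAt? a b c d)

  -- A vertex u ≠ b of the line cd determines the line through a and b, as the one through u and b.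
  hit-count : ∀ b c d → ∫ C (λ a → ⟦ Hit? a b c d ⟧) ≤ r * r
  hit-count b c d = begin
    ∫ C (λ a → ⟦ Hit? a b c d ⟧)                           ≤⟨ mono (λ a → ⟦⟧-∃ (HitAt? a b c d)) ⟩
    ∫ C (λ a → ∫ C (λ u → ⟦ HitAt? a b c d u ⟧))           ≤⟨ mono (λ a → mono λ u → split a u) ⟩
    ∫ C (λ a → ∫ C (λ u → ⟦ InLine? c d u ⟧ * ⟦ InLine? u b a ⟧))  ≡⟨ swap C C _ ⟩
    ∫ C (λ u → ∫ C (λ a → ⟦ InLine? c d u ⟧ * ⟦ InLine? u b a ⟧))  ≡⟨ ext (λ u → scale ⟦ InLine? c d u ⟧ _) ⟩
    ∫ C (λ u → ⟦ InLine? c d u ⟧ * ∫ C (λ a → ⟦ InLine? u b a ⟧))  ≤⟨ mono (λ u → *-monoʳ-≤ ⟦ InLine? c d u ⟧ (line-size u b)) ⟩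
    ∫ C (λ u → ⟦ InLine? c d u ⟧ * r)                      ≡⟨ scaleʳ r _ ⟩
    ∫ C (λ u → ⟦ InLine? c d u ⟧) * r                      ≤⟨ *-monoˡ-≤ r (line-size c d) ⟩
    r * r                                                  ∎
    where
    open ≤-Reasoning
    split : ∀ a u → ⟦ HitAt? a b c d u ⟧ ≤ ⟦ InLine? c d u ⟧ * ⟦ InLine? u b a ⟧
    split a u = ⟦⟧-≤ (HitAt? a b c d u) λ (u≢b , (_ , e , a∈e , b∈e , u∈e) , u∈cd) →
      ≤-reflexive (sym (cong₂ _*_ (⟦⟧-true (InLine? c d u) u∈cd) (⟦⟧-true (InLine? u b a) (u≢b , e , u∈e , b∈e , a∈e))))

  -- The line x₀x₁ hits one of the first i + 1 lines of the walk a ∷ w.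
  HitsPath : V → V → V → ∀ i {p} → Vec V (i + suc p) → Set
  HitsPath x₀ x₁ a zero    (b ∷ _) = Hit x₀ x₁ a b
  HitsPath x₀ x₁ a (suc i) (b ∷ w) = Hit x₀ x₁ a b ⊎ HitsPath x₀ x₁ b i w

  HitsPath? : ∀ x₀ x₁ a i {p} (w : Vec V (i + suc p)) → Dec (HitsPath x₀ x₁ a i w)
  HitsPath? x₀ x₁ a zero    (b ∷ _) = Hit? x₀ x₁ a b
  HitsPath? x₀ x₁ a (suc i) (b ∷ w) = Hit? x₀ x₁ a b ⊎-dec HitsPath? x₀ x₁ b i w

  -- The test does not look beyond `y`, so badness is independent of the remaining walk `v` and the
  -- weight factors at `y`.
  HitsPath-truncate : ∀ {x₀ x₁ i p} a (u : Vec V i) y (v : Vec V p) →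
    HitsPath x₀ x₁ a i (u ++ y ∷ v) → HitsPath x₀ x₁ a i (u ++ y ∷ [])
  HitsPath-truncate a []      y v h        = h
  HitsPath-truncate a (b ∷ u) y v (inj₁ h) = inj₁ h
  HitsPath-truncate a (b ∷ u) y v (inj₂ h) = inj₂ (HitsPath-truncate b u y v h)

  HitsPath-count : ∀ x₁ a i {p} (w : Vec V (i + suc p)) →
    ∫ C (λ x₀ → ⟦ HitsPath? x₀ x₁ a i w ⟧) ≤ suc i * (r * r)
  HitsPath-count x₁ a zero    (b ∷ w) = ≤-trans (hit-count x₁ a b) (≤-reflexive (sym (*-identityˡ (r * r))))
  HitsPath-count x₁ a (suc i) (b ∷ w) = ≤-trans (mono λ x₀ → ⟦⟧-⊎ (Hit? x₀ x₁ a b) (HitsPath? x₀ x₁ b i w))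
    (≤-trans (≤-reflexive (add _ _)) (+-mono-≤ (hit-count x₁ a b) (HitsPath-count x₁ b i w)))

-- Closed walks and their rotations

module _ {V : Set} where

  rot : ∀ {l} → Vec V (suc l) → Vec V (suc l)
  rot (x ∷ v) = v ∷ʳ x

  rotates : ∀ {l} → ℕ → Vec V (suc l) → Vec V (suc l)
  rotates zero    w = w
  rotates (suc i) w = rotates i (rot w)

  -- Reading by rotation makes the index unbounded and periodic, so that going round the cycle needs
  -- no remainders.
  at : ∀ {l} → Vec V (suc l) → ℕ → V
  at w i = head (rotates i w)

  at-rotates : ∀ {l} i j (w : Vec V (suc l)) → at (rotates i w) j ≡ at w (i + j)
  at-rotates zero    j w = refl
  at-rotates (suc i) j w = at-rotates i j (rot w)

  nth : ∀ {l} → V → Vec V l → ℕ → V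
  nth d []      _       = d
  nth d (x ∷ v) zero    = x
  nth d (x ∷ v) (suc i) = nth d v i

  nth-∷ʳ : ∀ {l} d (v : Vec V l) x {i} → i < l → nth d (v ∷ʳ x) i ≡ nth d v i
  nth-∷ʳ d (y ∷ v) x {zero}  _       = refl
  nth-∷ʳ d (y ∷ v) x {suc i} (s≤s h) = nth-∷ʳ d v x h

  nth-∷ʳ-last : ∀ {l} d (v : Vec V l) x → nth d (v ∷ʳ x) l ≡ x
  nth-∷ʳ-last d []      x = refl
  nth-∷ʳ-last d (y ∷ v) x = nth-∷ʳ-last d v x

  at-nth : ∀ {l} d (w : Vec V (suc l)) i → i < suc l → at w i ≡ nth d w i
  at-nth d (x ∷ v) zero    _       = refl
  at-nth d (x ∷ v) (suc i) (s≤s h) = trans (at-nth d (v ∷ʳ x) i (m<n⇒m<1+n h)) (nth-∷ʳ d v x h)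

  nth-lookup : ∀ {l} d (v : Vec V l) j → nth d v (toℕ j) ≡ lookup v j
  nth-lookup d (x ∷ v) zero    = refl
  nth-lookup d (x ∷ v) (suc j) = nth-lookup d v j

  at-lookup : ∀ {l} (w : Vec V (suc l)) j → at w (toℕ j) ≡ lookup w j
  at-lookup w j = trans (at-nth (head w) w (toℕ j) (toℕ<n j)) (nth-lookup (head w) w j)

  at-length : ∀ {l} (w : Vec V (suc l)) → at w (suc l) ≡ at w 0
  at-length {l} (x ∷ v) = trans (at-nth x (v ∷ʳ x) l ≤-refl) (nth-∷ʳ-last x v x)

  at-period : ∀ {l} (w : Vec V (suc l)) i → at w (i + suc l) ≡ at w i
  at-period {l} w i = begin
    at w (i + suc l)         ≡⟨ at-rotates i (suc l) w ⟨
    at (rotates i w) (suc l) ≡⟨ at-length (rotates i w) ⟩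
    at (rotates i w) 0       ≡⟨ at-rotates i 0 w ⟩
    at w (i + 0)             ≡⟨ cong (at w) (+-identityʳ i) ⟩
    at w i                   ∎
    where open ≡-Reasoning

  at-next : ∀ {l} (w : Vec V (suc l)) (j : Fin (suc l)) → at w (toℕ (next j)) ≡ at w (suc (toℕ j))
  at-next {l} w j with m≤n⇒m<n∨m≡n (toℕ<n j)
  ... | inj₁ lt = cong (at w) (trans (toℕ-fromℕ< (m%n<n (suc (toℕ j)) (suc l))) (m<n⇒m%n≡m lt))
  ... | inj₂ eq = trans (cong (at w) (trans (toℕ-fromℕ< (m%n<n (suc (toℕ j)) (suc l))) (trans (cong (_% suc l) eq) (n%n≡0 (suc l)))))
    (sym (trans (cong (at w) eq) (at-length w)))

rot-invariant : ∀ {V : Set} (I : Integral V) l (f : Vec V (suc l) → ℕ) →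
  ∫ (vectors I (suc l)) (f ∘ rot) ≡ ∫ (vectors I (suc l)) f
rot-invariant I l f = sym (vectors-∷ʳ I l f)

⟦⟧-positive : (p : Dec P) → 0 < ⟦ p ⟧ → P
⟦⟧-positive (yes p) _ = p

∈-tabulate⁺ : ∀ {m} {R : Fin m → Set} (R? : ∀ t → Dec (R t)) {t} → R t → t ∈ tabulate (does ∘ R?)
∈-tabulate⁺ R? {t} a = lookup⇒[]= t _ (trans (lookup∘tabulate (does ∘ R?) t) (dec-true (R? t) a))

∈-tabulate⁻ : ∀ {m} {R : Fin m → Set} (R? : ∀ t → Dec (R t)) {t} → t ∈ tabulate (does ∘ R?) → R t
∈-tabulate⁻ R? {t} t∈ with R? t | trans (sym (lookup∘tabulate (does ∘ R?) t)) ([]=⇒lookup t∈)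
... | yes a | _ = a

-- From good closed walks to linear cycles

module ClosedWalks {r n : ℕ} (G : LinearGraph r n) (μ : Fin n → ℕ) (p : ℕ) where

  open Lines G
  open WeightedGraph n A A-sym A≤1 μ hiding (V; C)

  -- With k = p + 2, i₀ is k - 1 and closed walks of length suc l = 2k are studied.
  i₀ l : ℕ
  i₀ = suc p
  l = suc (i₀ + suc p)

  Walk : Set
  Walk = Vec V (suc l)

  -- The vertex `x₁` is both the end of the tested line and the start of the walk ahead, of which
  -- `i₀ + 1 = k` lines, half the cycle, are tested.
  Bad : Walk → Set
  Bad (x₀ ∷ x₁ ∷ w) = HitsPath x₀ x₁ x₁ i₀ w

  Bad? : ∀ W → Dec (Bad W)
  Bad? (x₀ ∷ x₁ ∷ w) = HitsPath? x₀ x₁ x₁ i₀ w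

  -- The counter lets a union bound peel off one rotation at a time; `Good (suc l)` covers them all.
  Good : ℕ → Walk → Set
  Good zero    W = ⊤
  Good (suc c) W = ¬ Bad W × Good c (rot W)

  Good? : ∀ c W → Dec (Good c W)
  Good? zero    W = yes tt
  Good? (suc c) W = ¬? (Bad? W) ×-dec Good? c (rot W)

  HitsPath-intro : ∀ {x₀ x₁} d a i {p} (w : Vec V (i + suc p)) {t} → t ≤ i →
    Hit x₀ x₁ (nth d (a ∷ w) t) (nth d (a ∷ w) (suc t)) → HitsPath x₀ x₁ a i w
  HitsPath-intro d a zero    (b ∷ w) {zero}  _       h = h
  HitsPath-intro d a (suc i) (b ∷ w) {zero}  _       h = inj₁ h
  HitsPath-intro d a (suc i) (b ∷ w) {suc t} (s≤s q) h = inj₂ (HitsPath-intro d b i w q h)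

  hit⇒Bad : ∀ W {t} → t ≤ i₀ → Hit (at W 0) (at W 1) (at W (suc t)) (at W (suc (suc t))) → Bad W
  hit⇒Bad W@(x₀ ∷ x₁ ∷ w) {t} t≤i₀ h = HitsPath-intro x₀ x₁ i₀ w t≤i₀
    (subst₂ (Hit x₀ x₁) (at-nth x₀ W (suc t) (s≤s (m<n⇒m<1+n t<)))
      (at-nth x₀ W (suc (suc t)) (s≤s (s≤s t<))) h)
    where
    t< : t < i₀ + suc p
    t< = ≤-<-trans t≤i₀ (m<m+n i₀ (s≤s z≤n))

  Good⇒no-hit : ∀ {c} W → Good c W → ∀ {i t} → i < c → t ≤ i₀ →
    ¬ Hit (at W i) (at W (suc i)) (at W (i + suc t)) (at W (i + suc (suc t)))
  Good⇒no-hit {suc c} W (¬bad , _)  {zero}  _       t≤i₀ h = ¬bad (hit⇒Bad W t≤i₀ h)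
  Good⇒no-hit {suc c} W (_ , good) {suc i} (s≤s q) t≤i₀ h = Good⇒no-hit (rot W) good {i} q t≤i₀ h

  cycleWeight-rot : ∀ (W : Walk) → cycleWeight (rot W) ≡ cycleWeight W
  cycleWeight-rot (x ∷ y ∷ v) = trans (path-∷ʳ y v x y) (*-comm (path y v x) (A x y))

  steps : ∀ (W : Walk) → 0 < cycleWeight W → ∀ i → InLine (at W i) (at W (suc i)) (at W i)
  steps W@(x ∷ y ∷ v) pos zero = ⟦⟧-positive (InLine? x y x) (>-nonZero⁻¹ _ {{m*n≢0⇒m≢0 (A x y) {{>-nonZero pos}}}})
  steps W pos (suc i) = steps (rot W) (subst (0 <_) (sym (cycleWeight-rot W)) pos) i

  InEdgeSet? : ∀ (W : Walk) (t : Fin (m G)) →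
    Dec (∃ λ (j : Fin (suc l)) → at W (toℕ j) ∈ edge G t × at W (suc (toℕ j)) ∈ edge G t)
  InEdgeSet? W t = any? λ j → (at W (toℕ j) ∈? edge G t) ×-dec (at W (suc (toℕ j)) ∈? edge G t)

  edgeSet : Walk → Subset (m G)
  edgeSet W = tabulate (does ∘ InEdgeSet? W)

  module Copy (W : Walk) (pos : 0 < cycleWeight W) (good : Good (suc l) W) where

    x : ℕ → V
    x = at W

    E : ℕ → Fin (m G)
    E i = proj₁ (proj₂ (steps W pos i))

    x≢x⁺ : ∀ i → x i ≢ x (suc i)
    x≢x⁺ i = proj₁ (steps W pos i)

    x∈E : ∀ i → x i ∈ edge G (E i)
    x∈E i = proj₁ (proj₂ (proj₂ (steps W pos i)))

    x⁺∈E : ∀ i → x (suc i) ∈ edge G (E i)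
    x⁺∈E i = proj₁ (proj₂ (proj₂ (proj₂ (steps W pos i))))

    -- `E` is extracted from proofs at unbounded indices; periodicity is recovered because two
    -- distinct vertices determine their edge.
    E-period : ∀ i → E (i + suc l) ≡ E i
    E-period i = edge-unique (x≢x⁺ i)
      (subst (_∈ edge G (E (i + suc l))) (at-period W i) (x∈E (i + suc l)))
      (subst (_∈ edge G (E (i + suc l))) (at-period W (suc i)) (x⁺∈E (i + suc l)))
      (x∈E i) (x⁺∈E i)

    meet-ahead : ∀ {i t u} → i < suc l → t ≤ i₀ → u ∈ edge G (E i) → u ∈ edge G (E (i + suc t)) → u ≡ x (suc i)
    meet-ahead {i} {t} {u} i<L t≤i₀ u∈ u∈′ with u ≟ᶠ x (suc i)
    ... | yes eq = eq
    ... | no u≢ = contradiction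
      (u , u≢ , (x≢x⁺ i , E i , x∈E i , x⁺∈E i , u∈) ,
        subst (λ k → InLine (x (i + suc t)) (x k) u) (sym (+-suc i (suc t)))
          (x≢x⁺ (i + suc t) , E (i + suc t) , x∈E (i + suc t) , x⁺∈E (i + suc t) , u∈′))
      (Good⇒no-hit W good i<L t≤i₀)

    -- One of two distinct positions on the cycle is at most half way round ahead of the other.
    meet : ∀ {i i′ u} → i < i′ → i′ < suc l → u ∈ edge G (E i) → u ∈ edge G (E i′) →
           u ≡ x (suc i) ⊎ u ≡ x (suc i′)
    meet {i} {i′} {u} i<i′ i′<L u∈ u∈′ with m≤n⇒∃[o]m+o≡n i<i′
    ... | t , refl with t ≤? i₀
    ...   | yes t≤i₀ = inj₁ (meet-ahead (<-trans i<i′ i′<L) t≤i₀ u∈ (subst (λ k → u ∈ edge G (E k)) (sym (+-suc i t)) u∈′))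
    ...   | no t≰i₀ with m≤n⇒∃[o]m+o≡n (≰⇒> t≰i₀)
    ...     | t′ , refl with m≤n⇒∃[o]m+o≡n t′≤p
      where
      lhs : ∀ i p t → suc (suc (i + (suc (suc p) + t))) ≡ (4 + p) + (i + t)
      lhs = solve-∀
      rhs : ∀ p → suc (suc (suc p + suc p)) ≡ (4 + p) + p
      rhs = solve-∀
      t′≤p : t′ ≤ p
      t′≤p = ≤-trans (m≤n+m t′ i) (+-cancelˡ-≤ (4 + p) _ _ (subst₂ _≤_ (lhs i p t′) (rhs p) i′<L))
    -- Past half way the roles change: after one full turn, the edge `E i` is `q + 1` lines ahead of
    -- the later one, and `q` is at most `p`.
    ...       | q , t′+q≡p = inj₂ (meet-ahead i′<L (≤-trans (≤-trans (m≤n+m q t′) (≤-reflexive t′+q≡p)) (n≤1+n p)) u∈′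
      (subst (λ k → u ∈ edge G (E k)) (sym wrap) (subst (λ e → u ∈ edge G e) (sym (E-period i)) u∈)))
      where
      lhs : ∀ i p t q → suc i + (suc (suc p) + t) + suc q ≡ i + (4 + (p + (t + q)))
      lhs = solve-∀
      rhs : ∀ i p → i + (4 + (p + p)) ≡ i + suc (suc (suc p + suc p))
      rhs = solve-∀
      wrap : suc i + (suc (suc p) + t′) + suc q ≡ i + suc l
      wrap = trans (lhs i p t′ q) (trans (cong (λ z → i + (4 + (p + z))) t′+q≡p) (rhs i p))

    φ : CycleVertex l r → V
    φ (inj₁ j)       = x (toℕ j)
    φ (inj₂ (j , q)) = proj₁ (others (E (toℕ j)) (x (toℕ j)) (x (suc (toℕ j)))) q

    -- A core vertex belongs to the cycle edge that it starts, so the vertices owned by `j` map into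
    -- the edge `E (toℕ j)` away from `x (suc (toℕ j))`.
    owner : CycleVertex l r → Fin (suc l)
    owner (inj₁ j)       = j
    owner (inj₂ (j , _)) = j

    φ∈E : ∀ c → φ c ∈ edge G (E (toℕ (owner c)))
    φ∈E (inj₁ j)       = x∈E (toℕ j)
    φ∈E (inj₂ (j , q)) = proj₁ (proj₂ (proj₂ (others (E (toℕ j)) (x (toℕ j)) (x (suc (toℕ j))))) q)

    φ≢x⁺ : ∀ c → φ c ≢ x (suc (toℕ (owner c)))
    φ≢x⁺ (inj₁ j)       = x≢x⁺ (toℕ j)
    φ≢x⁺ (inj₂ (j , q)) = proj₂ (proj₂ (proj₂ (proj₂ (others (E (toℕ j)) (x (toℕ j)) (x (suc (toℕ j))))) q))

    inner≢x : ∀ j q → φ (inj₂ (j , q)) ≢ x (toℕ j)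
    inner≢x j q = proj₁ (proj₂ (proj₂ (proj₂ (others (E (toℕ j)) (x (toℕ j)) (x (suc (toℕ j))))) q))

    φ-injective-locally : ∀ c c′ → owner c ≡ owner c′ → φ c ≡ φ c′ → c ≡ c′
    φ-injective-locally (inj₁ j)       (inj₁ .j)        refl _  = refl
    φ-injective-locally (inj₁ j)       (inj₂ (.j , q))  refl eq = contradiction (sym eq) (inner≢x j q)
    φ-injective-locally (inj₂ (j , q)) (inj₁ .j)        refl eq = contradiction eq (inner≢x j q)
    φ-injective-locally (inj₂ (j , q)) (inj₂ (.j , q′)) refl eq =
      cong (λ q → inj₂ (j , q)) (proj₁ (proj₂ (others (E (toℕ j)) (x (toℕ j)) (x (suc (toℕ j))))) eq)

    -- A common image would lie on both edges, where `meet` allows only the end vertex of one of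
    -- them; `φ≢x⁺` excludes both.
    φ-separates : ∀ c c′ → toℕ (owner c) < toℕ (owner c′) → φ c ≢ φ c′
    φ-separates c c′ lt eq with meet lt (toℕ<n (owner c′)) (φ∈E c) (subst (_∈ edge G (E (toℕ (owner c′)))) (sym eq) (φ∈E c′))
    ... | inj₁ eq₁ = φ≢x⁺ c eq₁
    ... | inj₂ eq₂ = φ≢x⁺ c′ (trans (sym eq) eq₂)

    φ-injective : Injective _≡_ _≡_ φ
    φ-injective {c} {c′} eq with <-cmp (toℕ (owner c)) (toℕ (owner c′))
    ... | tri< lt _ _ = contradiction eq (φ-separates c c′ lt)
    ... | tri≈ _ e _  = φ-injective-locally c c′ (toℕ-injective e) eq
    ... | tri> _ _ gt = contradiction (sym eq) (φ-separates c′ c gt)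

    isCopy : IsCycleCopy l G (edgeSet W)
    isCopy = φ , E ∘ toℕ , φ-injective , incidence , λ t → mk⇔
      (λ t∈S → let (j , x∈t , x⁺∈t) = ∈-tabulate⁻ (InEdgeSet? W) t∈S in
        j , edge-unique (x≢x⁺ (toℕ j)) (x∈E (toℕ j)) (x⁺∈E (toℕ j)) x∈t x⁺∈t)
      (λ { (j , refl) → ∈-tabulate⁺ (InEdgeSet? W) (j , x∈E (toℕ j) , x⁺∈E (toℕ j)) })
      where
      incidence : ∀ j c → InCycleEdge {l} {r} j c → φ c ∈ edge G (E (toℕ j))
      incidence j _ left      = x∈E (toℕ j)
      incidence j _ right     = subst (_∈ edge G (E (toℕ j))) (sym (at-next W j)) (x⁺∈E (toℕ j))
      incidence j _ (inner q) = φ∈E (inj₂ (j , q))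

-- Good weight and the number of copies

allVecs : ∀ n l → List (Vec (Fin n) l)
allVecs n zero    = [] ∷ []
allVecs n (suc l) = cartesianProductWith _∷_ (allFin n) (allVecs n l)

∈-allVecs : ∀ {n l} (v : Vec (Fin n) l) → v ∈ᴸ allVecs n l
∈-allVecs []      = here refl
∈-allVecs (x ∷ v) = ∈-cartesianProductWith⁺ _∷_ (∈-allFin x) (∈-allVecs v)

module CountCopies {r n : ℕ} (G : LinearGraph r n) (μ : Fin n → ℕ) (p : ℕ) where

  open Lines G
  open WeightedGraph n A A-sym A≤1 μ hiding (V; C)
  open ClosedWalks G μ p
  private module W = Integral (vectors I (suc l))

  badWeight : ℕ
  badWeight = ∫ (vectors I (suc l)) (λ W → cycleWeight W * ⟦ Bad? W ⟧)

  goodWeight : ℕ → ℕ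
  goodWeight c = ∫ (vectors I (suc l)) (λ W → cycleWeight W * ⟦ Good? c W ⟧)

  -- A union bound over the first `c` rotations, each costing the same `badWeight` since rotation
  -- preserves measure and weight.
  weight≤good+bad : ∀ c → ∫ (vectors I (suc l)) cycleWeight ≤ goodWeight c + c * badWeight
  weight≤good+bad zero    = ≤-trans (≤-reflexive (W.ext λ W → sym (*-identityʳ (cycleWeight W)))) (m≤m+n _ 0)
  weight≤good+bad (suc c) = begin
    ∫ (vectors I (suc l)) cycleWeight                ≤⟨ weight≤good+bad c ⟩
    goodWeight c + c * badWeight                     ≤⟨ +-monoˡ-≤ (c * badWeight) peel ⟩
    (goodWeight (suc c) + badWeight) + c * badWeight ≡⟨ +-assoc (goodWeight (suc c)) badWeight (c * badWeight) ⟩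
    goodWeight (suc c) + suc c * badWeight           ∎
    where
    open ≤-Reasoning
    not-bad : ∀ {b g : Set} (b? : Dec b) (g? : Dec g) → ⟦ g? ⟧ ≤ ⟦ ¬? b? ×-dec g? ⟧ + ⟦ b? ⟧
    not-bad (yes _) (yes _) = ≤-refl
    not-bad (yes _) (no _)  = z≤n
    not-bad (no _)  (yes _) = ≤-refl
    not-bad (no _)  (no _)  = z≤n
    -- Rotating the variable first turns `Good c W` into the second half of `Good (suc c) W`.
    peel : goodWeight c ≤ goodWeight (suc c) + badWeight
    peel = begin
      goodWeight c
        ≡⟨ rot-invariant I l (λ W → cycleWeight W * ⟦ Good? c W ⟧) ⟨
      ∫ (vectors I (suc l)) (λ W → cycleWeight (rot W) * ⟦ Good? c (rot W) ⟧)
        ≡⟨ W.ext (λ W → cong (_* ⟦ Good? c (rot W) ⟧) (cycleWeight-rot W)) ⟩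
      ∫ (vectors I (suc l)) (λ W → cycleWeight W * ⟦ Good? c (rot W) ⟧)
        ≤⟨ W.mono (λ W → ≤-trans (*-monoʳ-≤ (cycleWeight W) (not-bad (Bad? W) (Good? c (rot W)))) (≤-reflexive (*-distribˡ-+ (cycleWeight W) ⟦ Good? (suc c) W ⟧ ⟦ Bad? W ⟧))) ⟩
      ∫ (vectors I (suc l)) (λ W → cycleWeight W * ⟦ Good? (suc c) W ⟧ + cycleWeight W * ⟦ Bad? W ⟧)
        ≡⟨ W.add (λ W → cycleWeight W * ⟦ Good? (suc c) W ⟧) (λ W → cycleWeight W * ⟦ Bad? W ⟧) ⟩
      goodWeight (suc c) + badWeight ∎

  β : V → V → Vec V i₀ → V → ℕ
  β x₀ x₁ u y = ⟦ HitsPath? x₀ x₁ x₁ i₀ (u ++ y ∷ []) ⟧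

  module BadWeight {M K : ℕ} (μ-bound : ∀ x → M * μ x ≤ K) (degree-bound : ∀ x → n * (μ x * degree x) ≤ K) where

    open BadMass {p = p} {s = suc i₀ * (r * r)} {M} {K} β (λ x₀ x₁ u y → ⟦⟧≤1 (HitsPath? x₀ x₁ x₁ i₀ (u ++ y ∷ [])))
      (λ x₁ u y → HitsPath-count x₁ x₁ i₀ (u ++ y ∷ [])) μ-bound degree-bound

    -- The cut is at `y`: the `k` steps from `x₁` to `y` carry the badness, and the `k - 1` steps
    -- back to `x₀` are unrestricted.
    badWeight≤badMass : badWeight ≤ badMass
    badWeight≤badMass = I.mono λ x₀ → I.mono λ x₁ → begin
      ∫ (vectors I (i₀ + suc p)) (λ w → A x₀ x₁ * path x₁ w x₀ * ⟦ HitsPath? x₀ x₁ x₁ i₀ w ⟧)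
        ≡⟨ trans (vectors-++ I i₀ p (λ w → A x₀ x₁ * path x₁ w x₀ * ⟦ HitsPath? x₀ x₁ x₁ i₀ w ⟧))
             (swap U I (λ u y → ∫ V′ (λ v → A x₀ x₁ * path x₁ (u ++ y ∷ v) x₀ * ⟦ HitsPath? x₀ x₁ x₁ i₀ (u ++ y ∷ v) ⟧))) ⟩
      ∫ I (λ y → ∫ U (λ u → ∫ V′ (λ v → A x₀ x₁ * path x₁ (u ++ y ∷ v) x₀ * ⟦ HitsPath? x₀ x₁ x₁ i₀ (u ++ y ∷ v) ⟧)))
        ≤⟨ I.mono (λ y → Integral.mono U λ u → Integral.mono V′ λ v → factor x₀ x₁ u y v) ⟩
      ∫ I (λ y → ∫ U (λ u → ∫ V′ (λ v → A x₀ x₁ * (path x₁ u y * β x₀ x₁ u y * path y v x₀))))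
        ≡⟨ I.ext (λ y → trans (Integral.scale (U ⊗ V′) (A x₀ x₁) (λ (u , v) → path x₁ u y * β x₀ x₁ u y * path y v x₀))
             (cong (A x₀ x₁ *_) (trans (∫∫-product U V′ (λ u → path x₁ u y * β x₀ x₁ u y) (λ v → path y v x₀)) (cong (badPow x₀ x₁ y *_) (∫-path p y x₀))))) ⟩
      ∫ I (λ y → A x₀ x₁ * (badPow x₀ x₁ y * pow p y x₀)) ∎
      where
      open ≤-Reasoning
      U = vectors I i₀
      V′ = vectors I p
      regroup : ∀ a b c d → a * (b * c) * d ≡ a * (b * d * c)
      regroup = solve-∀
      factor : ∀ x₀ x₁ u y (v : Vec V p) →
        A x₀ x₁ * path x₁ (u ++ y ∷ v) x₀ * ⟦ HitsPath? x₀ x₁ x₁ i₀ (u ++ y ∷ v) ⟧ ≤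
        A x₀ x₁ * (path x₁ u y * β x₀ x₁ u y * path y v x₀)
      factor x₀ x₁ u y v = begin
        A x₀ x₁ * path x₁ (u ++ y ∷ v) x₀ * ⟦ HitsPath? x₀ x₁ x₁ i₀ (u ++ y ∷ v) ⟧
          ≤⟨ *-monoʳ-≤ (A x₀ x₁ * path x₁ (u ++ y ∷ v) x₀) (⟦⟧-mono (HitsPath? x₀ x₁ x₁ i₀ (u ++ y ∷ v)) (HitsPath? x₀ x₁ x₁ i₀ (u ++ y ∷ [])) (HitsPath-truncate x₁ u y v)) ⟩
        A x₀ x₁ * path x₁ (u ++ y ∷ v) x₀ * β x₀ x₁ u y
          ≡⟨ cong (λ z → A x₀ x₁ * z * β x₀ x₁ u y) (path-++ x₁ u y v x₀) ⟩
        A x₀ x₁ * (path x₁ u y * path y v x₀) * β x₀ x₁ u y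
          ≡⟨ regroup (A x₀ x₁) (path x₁ u y) (path y v x₀) (β x₀ x₁ u y) ⟩
        A x₀ x₁ * (path x₁ u y * β x₀ x₁ u y * path y v x₀) ∎

    badWeight-bound : (M * n) * (badWeight * badWeight) ≤ (K * (suc i₀ * (r * r) * moment i₀)) * (K * moment p)
    badWeight-bound = ≤-trans (*-monoʳ-≤ (M * n) (*-mono-≤ badWeight≤badMass badWeight≤badMass)) badMass-bound

  Valid : Walk → Set
  Valid W = 0 < cycleWeight W × Good (suc l) W

  Valid? : ∀ W → Dec (Valid W)
  Valid? W = (0 <? cycleWeight W) ×-dec Good? (suc l) W

  _≟ˢ_ : (S T : Subset (m G)) → Dec (S ≡ T)
  _≟ˢ_ = ≡-dec _≟ᵇ_

  -- Walks round the same copy share their edge set, whence the deduplication.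
  copies : List (Subset (m G))
  copies = deduplicate _≟ˢ_ (map edgeSet (filter Valid? (allVecs n (suc l))))

  copies-unique : Unique copies
  copies-unique = deduplicate-! _≟ˢ_ _

  copies-are-copies : All (IsCycleCopy l G) copies
  copies-are-copies = All.deduplicate⁺ _≟ˢ_ (All.map⁺ (All.map (λ {W} (pos , good) → Copy.isCopy W pos good) (All.all-filter Valid? (allVecs n (suc l)))))

  Covered? : ∀ (S : Subset (m G)) x → Dec (∃ λ e → e ∈ S × x ∈ edge G e)
  Covered? S x = any? λ e → (e ∈? S) ×-dec (x ∈? edge G e)

  -- A product of indicators, so that integration over independent coordinates gives a power.
  cover : ∀ {a} → Subset (m G) → Vec V a → ℕ
  cover S []      = 1
  cover S (x ∷ v) = ⟦ Covered? S x ⟧ * cover S v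

  ∫-cover : ∀ S a → ∫ (vectors I a) (cover S) ≡ ∫ I (λ x → ⟦ Covered? S x ⟧) ^ a
  ∫-cover S zero    = refl
  ∫-cover S (suc a) = trans (∫∫-product I (vectors I a) _ _) (cong (∫ I (λ x → ⟦ Covered? S x ⟧) *_) (∫-cover S a))

  cover-positive : ∀ {a} S (v : Vec V a) → (∀ j → ∃ λ e → e ∈ S × lookup v j ∈ edge G e) → 1 ≤ cover S v
  cover-positive S []      _ = ≤-refl
  cover-positive S (x ∷ v) h = *-mono-≤ (≤-reflexive (sym (⟦⟧-true (Covered? S x) (h zero)))) (cover-positive S v (h ∘ suc))

  cover-edgeSet : ∀ W → 0 < cycleWeight W → 1 ≤ cover (edgeSet W) W
  cover-edgeSet W pos = cover-positive (edgeSet W) W λ j →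
    let (_ , e , x∈e , x⁺∈e , _) = steps W pos (toℕ j) in
    e , ∈-tabulate⁺ (InEdgeSet? W) (j , x∈e , x⁺∈e) , subst (_∈ edge G e) (at-lookup W j) x∈e

  path≤1 : ∀ {a} x (v : Vec V a) z → path x v z ≤ 1
  path≤1 x []      z = A≤1 x z
  path≤1 x (y ∷ v) z = *-mono-≤ (A≤1 x y) (path≤1 y v z)

  cycleWeight≤1 : ∀ (W : Walk) → cycleWeight W ≤ 1
  cycleWeight≤1 (x ∷ v) = path≤1 x v x

  -- Each contributing walk is charged to the copy that it traces, whose edges contain all its
  -- vertices.
  goodWeight≤ : goodWeight (suc l) ≤ sumFin (length copies) (λ q → ∫ (vectors I (suc l)) (cover (lookupᴸ copies q)))
  goodWeight≤ = ≤-trans (W.mono pointwise) (≤-reflexive (swap (vectors I (suc l)) (counting (length copies)) (λ W q → cover (lookupᴸ copies q) W)))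
    where
    pointwise : ∀ W → cycleWeight W * ⟦ Good? (suc l) W ⟧ ≤ sumFin (length copies) (λ q → cover (lookupᴸ copies q) W)
    pointwise W with Valid? W
    ... | no ¬valid = ≤-trans (≤-reflexive (vanish (cycleWeight W) (Good? (suc l) W) (λ pos good → ¬valid (pos , good)))) z≤n
      where
      vanish : ∀ c {Q : Set} (q : Dec Q) → (0 < c → ¬ Q) → c * ⟦ q ⟧ ≡ 0
      vanish zero    q h = refl
      vanish (suc c) q h = trans (cong (suc c *_) (⟦⟧-false q (h (s≤s z≤n)))) (*-zeroʳ (suc c))
    ... | yes valid = begin
      cycleWeight W * ⟦ Good? (suc l) W ⟧ ≤⟨ *-mono-≤ (cycleWeight≤1 W) (⟦⟧≤1 (Good? (suc l) W)) ⟩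
      1                                   ≤⟨ cover-edgeSet W (proj₁ valid) ⟩
      cover (edgeSet W) W                 ≡⟨ cong (λ S → cover S W) (lookup-index W∈) ⟩
      cover (lookupᴸ copies (Any.index W∈)) W ≤⟨ term≤sumFin (length copies) (λ q → cover (lookupᴸ copies q) W) (Any.index W∈) ⟩
      _ ∎
      where
      open ≤-Reasoning
      W∈ : edgeSet W ∈ᴸ copies
      W∈ = ∈-deduplicate⁺ _≟ˢ_ (∈-map⁺ edgeSet (∈-filter⁺ Valid? (∈-allVecs W) valid))

  module _ {M K : ℕ} (μ-bound : ∀ x → M * μ x ≤ K) where
    open ≤-Reasoning
    open Integral C hiding (∫)

    covered-count : ∀ {S} → IsCycleCopy l G S → ∫ C (λ x → ⟦ Covered? S x ⟧) ≤ suc l * r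
    covered-count {S} (_ , g , _ , _ , S≡) = begin
      ∫ C (λ x → ⟦ Covered? S x ⟧)
        ≤⟨ mono (λ x → ≤-trans (⟦⟧-mono (Covered? S x) (any? (in-g? x)) (λ (e , e∈S , x∈e) →
             let (j , gj≡e) = Equivalence.to (S≡ e) e∈S in j , subst (λ e → x ∈ edge G e) (sym gj≡e) x∈e))
             (⟦⟧-∃ (in-g? x))) ⟩
      ∫ C (λ x → ∫ J (λ j → ⟦ in-g? x j ⟧))           ≡⟨ swap C J (λ x j → ⟦ in-g? x j ⟧) ⟩
      ∫ J (λ j → ∫ C (λ x → ⟦ in-g? x j ⟧))           ≡⟨ Integral.ext J (λ j → trans (card-sum (edge G (g j))) (uniform G (g j))) ⟩
      ∫ J (λ _ → r)                                   ≡⟨ sumFin-const (suc l) r ⟩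
      suc l * r                                       ∎
      where
      J = counting (suc l)
      in-g? : ∀ x j → Dec (x ∈ edge G (g j))
      in-g? x j = x ∈? edge G (g j)

    -- Each coordinate ranges over at most `suc l * r` covered vertices, of weight at most `K / M`.
    copy-weight : ∀ {S} → IsCycleCopy l G S → M ^ suc l * ∫ (vectors I (suc l)) (cover S) ≤ (K * (suc l * r)) ^ suc l
    copy-weight {S} copy = begin
      M ^ suc l * ∫ (vectors I (suc l)) (cover S)                ≡⟨ cong (M ^ suc l *_) (∫-cover S (suc l)) ⟩
      M ^ suc l * ∫ I (λ x → ⟦ Covered? S x ⟧) ^ suc l           ≡⟨ ^-distribʳ-* M _ (suc l) ⟨
      (M * ∫ I (λ x → ⟦ Covered? S x ⟧)) ^ suc l                 ≤⟨ ^-monoˡ-≤ (suc l) one-vertex ⟩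
      (K * (suc l * r)) ^ suc l                                  ∎
      where
      one-vertex : M * ∫ I (λ x → ⟦ Covered? S x ⟧) ≤ K * (suc l * r)
      one-vertex = begin
        M * ∫ I (λ x → ⟦ Covered? S x ⟧)             ≡⟨ scale M _ ⟨
        ∫ C (λ x → M * (μ x * ⟦ Covered? S x ⟧))     ≤⟨ mono (λ x → ≤-trans (≤-reflexive (sym (*-assoc M (μ x) _))) (*-monoˡ-≤ _ (μ-bound x))) ⟩
        ∫ C (λ x → K * ⟦ Covered? S x ⟧)             ≡⟨ scale K _ ⟩
        K * ∫ C (λ x → ⟦ Covered? S x ⟧)             ≤⟨ *-monoʳ-≤ K (covered-count copy) ⟩
        K * (suc l * r)                              ∎

    goodWeight-bound : M ^ suc l * goodWeight (suc l) ≤ length copies * (K * (suc l * r)) ^ suc l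
    goodWeight-bound = begin
      M ^ suc l * goodWeight (suc l)
        ≤⟨ *-monoʳ-≤ (M ^ suc l) goodWeight≤ ⟩
      M ^ suc l * sumFin (length copies) (λ q → ∫ (vectors I (suc l)) (cover (lookupᴸ copies q)))
        ≡⟨ sumFin-scale (length copies) (M ^ suc l) _ ⟨
      sumFin (length copies) (λ q → M ^ suc l * ∫ (vectors I (suc l)) (cover (lookupᴸ copies q)))
        ≤⟨ sumFin-mono (length copies) (λ q → copy-weight (All.lookup copies-are-copies (∈-lookup {xs = copies} q))) ⟩
      sumFin (length copies) (λ _ → (K * (suc l * r)) ^ suc l)
        ≡⟨ sumFin-const (length copies) _ ⟩
      length copies * (K * (suc l * r)) ^ suc l ∎

-- Arithmetic of the final comparison

square-cancel-≤ : ∀ {a b} → a * a ≤ b * b → a ≤ b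
square-cancel-≤ {a} {b} h with a ≤? b
... | yes a≤b = a≤b
... | no a≰b  = contradiction h (<⇒≱ (*-mono-< (≰⇒> a≰b) (≰⇒> a≰b)))

^-cancelˡ-≤ : ∀ k .{{_ : NonZero k}} {a b} → a ^ k ≤ b ^ k → a ≤ b
^-cancelˡ-≤ k {a} {b} h with a ≤? b
... | yes a≤b = a≤b
... | no a≰b  = contradiction h (<⇒≱ (^-monoˡ-< k (≰⇒> a≰b)))

-- Here `N` is the bad weight, and `T` and `T′` are consecutive moments. `h₁` is raised to the power
-- `k` because `h₂` controls only `T′ ^ k`; this yields `T` to the power `2k - 1`, and `h₃` supplies
-- the missing factor.
bad-small : ∀ p {n M K s T T′ N} z .{{_ : NonZero n}} .{{_ : NonZero s}} → let k = 2 + p in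
  (M * n) * (N * N) ≤ (K * (s * T)) * (K * T′) →
  T′ ^ k ≤ n * T ^ (1 + p) →
  (K * K) ^ k ≤ (4 * (n * n)) ^ k * T →
  (4 * s * (z * z)) ^ k * n ^ (1 + k) ≤ M ^ k →
  z * N ≤ T
bad-small p {n} {M} {K} {s} {T} {T′} {N} z h₁ h₂ h₃ h₄ =
  square-cancel-≤ (^-cancelˡ-≤ k (*-cancelʳ-≤ _ _ Z {{Z≢0}} (begin
    ((z * N) * (z * N)) ^ k * Z                              ≡⟨ rearrange₁ ⟩
    ((4 * s * (z * z)) ^ k * n ^ (1 + k)) * (n * (N * N)) ^ k ≤⟨ *-monoˡ-≤ _ h₄ ⟩
    M ^ k * (n * (N * N)) ^ k                                ≡⟨ ^-distribʳ-* M (n * (N * N)) k ⟨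
    (M * (n * (N * N))) ^ k                                  ≡⟨ cong (_^ k) (*-assoc M n (N * N)) ⟨
    ((M * n) * (N * N)) ^ k                                  ≤⟨ ^-monoˡ-≤ k h₁ ⟩
    ((K * (s * T)) * (K * T′)) ^ k                           ≡⟨ rearrange₂ ⟩
    (K * K) ^ k * ((s * T) ^ k * T′ ^ k)                     ≤⟨ *-mono-≤ h₃ (*-monoʳ-≤ ((s * T) ^ k) h₂) ⟩
    ((4 * (n * n)) ^ k * T) * ((s * T) ^ k * (n * T ^ (1 + p))) ≡⟨ rearrange₃ ⟩
    (T * T) ^ k * Z                                          ∎)))
  where
  open ≤-Reasoning
  k = 2 + p
  -- What stands beside `(T * T) ^ k` at the end of the chain; multiplying by it replaces division.
  Z = (4 * s * (n * n)) ^ k * n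
  Z≢0 : NonZero Z
  Z≢0 = m*n≢0 ((4 * s * (n * n)) ^ k) n {{m^n≢0 (4 * s * (n * n)) k {{m*n≢0 (4 * s) (n * n) {{m*n≢0 4 s}} {{m*n≢0 n n}}}}}}
  rearrange₁ : ((z * N) * (z * N)) ^ k * Z ≡ ((4 * s * (z * z)) ^ k * n ^ (1 + k)) * (n * (N * N)) ^ k
  rearrange₁ = begin-equality
    a ^ k * (b ^ k * n)              ≡⟨ *-assoc (a ^ k) (b ^ k) n ⟨
    a ^ k * b ^ k * n                ≡⟨ cong (_* n) (^-distribʳ-* a b k) ⟨
    (a * b) ^ k * n                  ≡⟨ cong (λ y → y ^ k * n) (base z N s n) ⟩
    (c * n * d) ^ k * n              ≡⟨ cong (_* n) (trans (^-distribʳ-* (c * n) d k) (cong (_* d ^ k) (^-distribʳ-* c n k))) ⟩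
    c ^ k * n ^ k * d ^ k * n        ≡⟨ move (c ^ k) (n ^ k) (d ^ k) n ⟩
    (c ^ k * (n * n ^ k)) * d ^ k    ∎
    where
    a = (z * N) * (z * N)
    b = 4 * s * (n * n)
    c = 4 * s * (z * z)
    d = n * (N * N)
    base : ∀ z N s n → ((z * N) * (z * N)) * (4 * s * (n * n)) ≡ (4 * s * (z * z)) * n * (n * (N * N))
    base = solve-∀
    move : ∀ a b c d → a * b * c * d ≡ (a * (d * b)) * c
    move = solve-∀
  rearrange₂ : ((K * (s * T)) * (K * T′)) ^ k ≡ (K * K) ^ k * ((s * T) ^ k * T′ ^ k)
  rearrange₂ = begin-equality
    ((K * (s * T)) * (K * T′)) ^ k         ≡⟨ cong (_^ k) (*-interchange K (s * T) K T′) ⟩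
    ((K * K) * ((s * T) * T′)) ^ k         ≡⟨ ^-distribʳ-* (K * K) ((s * T) * T′) k ⟩
    (K * K) ^ k * ((s * T) * T′) ^ k       ≡⟨ cong ((K * K) ^ k *_) (^-distribʳ-* (s * T) T′ k) ⟩
    (K * K) ^ k * ((s * T) ^ k * T′ ^ k)   ∎
  rearrange₃ : ((4 * (n * n)) ^ k * T) * ((s * T) ^ k * (n * T ^ (1 + p))) ≡ (T * T) ^ k * Z
  rearrange₃ = begin-equality
    (F * T) * ((s * T) ^ k * (n * H))        ≡⟨ cong (λ y → (F * T) * (y * (n * H))) (^-distribʳ-* s T k) ⟩
    (F * T) * ((s ^ k * (T * H)) * (n * H))  ≡⟨ move F T (s ^ k) H n ⟩
    ((T * H) * (T * H)) * ((F * s ^ k) * n)  ≡⟨ cong₂ (λ y w → y * (w * n)) (^-distribʳ-* T T k) (^-distribʳ-* (4 * (n * n)) s k) ⟨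
    (T * T) ^ k * ((4 * (n * n) * s) ^ k * n) ≡⟨ cong (λ y → (T * T) ^ k * (y ^ k * n)) (base s (n * n)) ⟩
    (T * T) ^ k * Z                          ∎
    where
    F = (4 * (n * n)) ^ k
    H = T ^ (1 + p)
    base : ∀ s a → 4 * a * s ≡ 4 * s * a
    base = solve-∀
    move : ∀ F T S H n → (F * T) * ((S * (T * H)) * (n * H)) ≡ ((T * H) * (T * H)) * ((F * S) * n)
    move = solve-∀

square-^ : ∀ a k → (a * a) ^ k ≡ a ^ (k + k)
square-^ a k = trans (^-distribʳ-* a a k) (sym (^-distribˡ-+-* a k k))

-- `h₁` and `h₂` leave at least half of `T` to `g`; then the upper bound on `g` by `c` copies meets
-- the lower bound on `T`.
copies-lower-bound : ∀ k {n M K T N g c d} → let L = k + k in .{{_ : NonZero K}} →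
  T ≤ g + L * N → (2 * L) * N ≤ T →
  M ^ L * g ≤ c * (K * d) ^ L →
  (K * K) ^ k ≤ (4 * (n * n)) ^ k * T →
  M ^ L ≤ (2 * 4 ^ k * d ^ L) * (c * n ^ L)
copies-lower-bound k {n} {M} {K} {T} {N} {g} {c} {d} h₁ h₂ h₃ h₄ = *-cancelˡ-≤ (K ^ L) {{m^n≢0 K L}} (begin
  K ^ L * M ^ L                              ≡⟨ cong (_* M ^ L) (square-^ K k) ⟨
  (K * K) ^ k * M ^ L                        ≤⟨ *-monoˡ-≤ (M ^ L) h₄ ⟩
  F * T * M ^ L                              ≤⟨ *-monoˡ-≤ (M ^ L) (*-monoʳ-≤ F T≤2g) ⟩
  F * (2 * g) * M ^ L                        ≡⟨ move₁ F g (M ^ L) ⟩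
  2 * F * (M ^ L * g)                        ≤⟨ *-monoʳ-≤ (2 * F) h₃ ⟩
  2 * F * (c * (K * d) ^ L)                  ≡⟨ cong₂ (λ y w → 2 * y * (c * w)) F≡ (^-distribʳ-* K d L) ⟩
  2 * (4 ^ k * n ^ L) * (c * (K ^ L * d ^ L)) ≡⟨ move₂ (4 ^ k) (n ^ L) c (K ^ L) (d ^ L) ⟩
  K ^ L * ((2 * 4 ^ k * d ^ L) * (c * n ^ L)) ∎)
  where
  open ≤-Reasoning
  L = k + k
  F = (4 * (n * n)) ^ k
  F≡ : F ≡ 4 ^ k * n ^ L
  F≡ = trans (^-distribʳ-* 4 (n * n) k) (cong (4 ^ k *_) (square-^ n k))
  T≤2g : T ≤ 2 * g
  T≤2g = +-cancelʳ-≤ T T (2 * g) (begin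
    T + T                          ≤⟨ +-mono-≤ h₁ h₁ ⟩
    (g + L * N) + (g + L * N)      ≡⟨ move₃ g L N ⟩
    2 * g + (2 * L) * N            ≤⟨ +-monoʳ-≤ (2 * g) h₂ ⟩
    2 * g + T                      ∎)
    where
    move₃ : ∀ g L N → (g + L * N) + (g + L * N) ≡ 2 * g + (2 * L) * N
    move₃ = solve-∀
  move₁ : ∀ F g m → F * (2 * g) * m ≡ 2 * F * (m * g)
  move₁ = solve-∀
  move₂ : ∀ a b c e f → 2 * (a * b) * (c * (e * f)) ≡ e * ((2 * a * f) * (c * b))
  move₂ = solve-∀

-- Choice of the weights and assembly

module Supersaturation {r n : ℕ} (G : LinearGraph r n) (2≤r : 2 ≤ r) (p : ℕ)
  .{{_ : NonZero n}} .{{_ : NonZero (m G)}} where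

  k L s : ℕ
  k = 2 + p
  L = k + k
  s = k * (r * r)

  open Lines G using (A; A-sym; A≤1; m≤∑A)

  M = m G

  D : Fin n → ℕ
  D x = n * ∫ (counting n) (A x) + M

  D≢0 : ∀ x → NonZero (D x)
  D≢0 x = >-nonZero (≤-trans (>-nonZero⁻¹ M) (m≤n+m M _))

  K : ℕ
  K = product (map D (allFin n))

  instance
    K≢0 : NonZero K
    K≢0 = product≢0 (All.map⁺ (universal D≢0 (allFin n)))

  D∣K : ∀ x → D x ∣ K
  D∣K x = ∈⇒∣product (∈-map⁺ D (∈-allFin x))

  μ : Fin n → ℕ
  μ x = quotient (D∣K x)

  μ-inverse : ∀ x → μ x * D x ≡ K
  μ-inverse x = sym (_∣_.equality (D∣K x))

  open WeightedGraph n A A-sym A≤1 μ using (degree; moment; moment-interpolate; ∫-cycleWeight; cycleWeight; I; module MomentLowerBound)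
  open ClosedWalks G μ p using (l; i₀)
  open CountCopies G μ p

  μ-bound : ∀ x → M * μ x ≤ K
  μ-bound x = ≤-trans (≤-trans (≤-reflexive (*-comm M (μ x))) (*-monoʳ-≤ (μ x) (m≤n+m M _))) (≤-reflexive (μ-inverse x))

  degree-bound : ∀ x → n * (μ x * degree x) ≤ K
  degree-bound x = ≤-trans (≤-trans (≤-reflexive (*-left-comm n (μ x) (degree x))) (*-monoʳ-≤ (μ x) (m≤m+n _ M))) (≤-reflexive (μ-inverse x))

  length≡ : suc l ≡ L
  length≡ = cong (λ j → suc (suc j)) (sym (+-suc p (suc p)))

  weight≡moment : ∫ (vectors I (suc l)) cycleWeight ≡ moment i₀
  -- The two lengths agree only propositionally; generalising over `a` lets the equation be matched.
  weight≡moment = by-length (cong suc (sym (+-suc p (suc p))))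
    where
    by-length : ∀ {a} → a ≡ i₀ + suc i₀ → ∫ (vectors I (suc a)) cycleWeight ≡ moment i₀
    by-length refl = ∫-cycleWeight i₀

  many-copies : (4 * s * ((2 * L) * (2 * L))) ^ k * n ^ (1 + k) ≤ M ^ k →
    M ^ L ≤ (2 * 4 ^ k * (L * r) ^ L) * (length copies * n ^ L)
  many-copies h = copies-lower-bound k {n} {M} {K} {moment i₀} {badWeight} {goodWeight (suc l)} {length copies} {L * r}
    (subst₂ (λ t c → t ≤ goodWeight (suc l) + c * badWeight) weight≡moment length≡ (weight≤good+bad (suc l)))
    -- With `z = 2 * L`, the `L` rotations together lose at most half the weight.
    (bad-small p {n} {M} {K} {s} {moment i₀} {moment p} {badWeight} (2 * L) {{it}} {{m*n≢0 k (r * r) {{it}} {{m*n≢0 r r {{r≢0}} {{r≢0}}}}}}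
      (BadWeight.badWeight-bound {M} {K} μ-bound degree-bound) (moment-interpolate p) lower h)
    (subst (λ c → M ^ c * goodWeight (suc l) ≤ length copies * (K * (c * r)) ^ c) length≡ (goodWeight-bound {M} {K} μ-bound))
    lower
    where
    r≢0 : NonZero r
    r≢0 = >-nonZero (≤-trans (s≤s z≤n) 2≤r)
    lower : (K * K) ^ k ≤ (4 * (n * n)) ^ k * moment i₀
    lower = MomentLowerBound.moment-lower-bound μ-inverse (m≤∑A 2≤r) i₀

vertices-nonZero : ∀ {r n} → 2 ≤ r → (G : LinearGraph r n) → .{{NonZero (m G)}} → NonZero n
vertices-nonZero {r} {n} 2≤r G = >-nonZero (begin-strict
  0                <⟨ ≤-trans (s≤s z≤n) 2≤r ⟩
  r                ≡⟨ uniform G e ⟨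
  ∣ edge G e ∣     ≤⟨ ∣p∣≤n (edge G e) ⟩
  n                ∎)
  where
  open ≤-Reasoning
  e : Fin (m G)
  e = fromℕ< (>-nonZero⁻¹ (m G))

supersaturation : ∀ p r → 2 ≤ r → let k = 2 + p ; L = k + k in
  ∀ n (G : LinearGraph r n) →
  (4 * (k * (r * r)) * ((2 * L) * (2 * L))) ^ k * n ^ (1 + k) ≤ m G ^ k →
  Σ (List (Subset (m G))) λ copies → Unique copies × All (IsCycleCopy (L ∸ 1) G) copies ×
    m G ^ L ≤ (2 * 4 ^ k * (L * r) ^ L) * (length copies * n ^ L)
supersaturation p r 2≤r n G h with m G ≟ 0
-- Edgeless graphs stand apart, as a nonzero `m G` is what keeps every `D x` positive. Here `0 ^ L`
-- vanishes because `L` is a successor.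
... | yes m≡0 = [] , [] , [] , subst (λ M → M ^ L ≤ (2 * 4 ^ k * (L * r) ^ L) * (0 * n ^ L)) (sym m≡0) z≤n
  where
  k = 2 + p
  L = k + k
... | no m≢0 =
  copies , copies-unique , subst (λ L → All (IsCycleCopy (L ∸ 1) G) copies) length≡ copies-are-copies , many-copies h
  where
  instance
    m-nonZero : NonZero (m G)
    m-nonZero = ≢-nonZero m≢0
    n-nonZero : NonZero n
    n-nonZero = vertices-nonZero 2≤r G
  open Supersaturation G 2≤r p
  open CountCopies G μ p using (copies; copies-unique; copies-are-copies)

-- From natural numbers to rationals

toℚᵘ-ℕ→ℚ : ∀ a → toℚᵘ (ℕ→ℚ a) ℚᵘ.≃ mkℚᵘ (ℤ.+ a) 0
toℚᵘ-ℕ→ℚ a = ℚ.toℚᵘ-fromℚᵘ (mkℚᵘ (ℤ.+ a) 0)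

ℕ→ℚ-* : ∀ a b → ℕ→ℚ (a * b) ≡ ℕ→ℚ a *ℚ ℕ→ℚ b
ℕ→ℚ-* a b = ℚ.toℚᵘ-injective (begin
  toℚᵘ (ℕ→ℚ (a * b))                 ≈⟨ toℚᵘ-ℕ→ℚ (a * b) ⟩
  mkℚᵘ (ℤ.+ (a * b)) 0                 ≈⟨ *≡* (cong (ℤ._* ℤ.+ 1) (ℤ.pos-* a b)) ⟩
  mkℚᵘ (ℤ.+ a) 0 ℚᵘ.* mkℚᵘ (ℤ.+ b) 0     ≈⟨ ℚᵘ.*-cong (toℚᵘ-ℕ→ℚ a) (toℚᵘ-ℕ→ℚ b) ⟨
  toℚᵘ (ℕ→ℚ a) ℚᵘ.* toℚᵘ (ℕ→ℚ b)     ≈⟨ ℚ.toℚᵘ-homo-* (ℕ→ℚ a) (ℕ→ℚ b) ⟨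
  toℚᵘ (ℕ→ℚ a *ℚ ℕ→ℚ b)              ∎)
  where open ℚᵘ.≃-Reasoning

ℕ→ℚ-^ : ∀ a k → ℕ→ℚ (a ^ k) ≡ ℕ→ℚ a ^ℚ k
ℕ→ℚ-^ a zero    = refl
ℕ→ℚ-^ a (suc k) = trans (ℕ→ℚ-* a (a ^ k)) (cong (ℕ→ℚ a *ℚ_) (ℕ→ℚ-^ a k))

ℕ→ℚ-mono-≤ : ∀ {a b} → a ≤ b → ℕ→ℚ a ≤ℚ ℕ→ℚ b
ℕ→ℚ-mono-≤ {a} {b} a≤b = ℚ.toℚᵘ-cancel-≤ (begin
  toℚᵘ (ℕ→ℚ a)   ≃⟨ toℚᵘ-ℕ→ℚ a ⟩
  mkℚᵘ (ℤ.+ a) 0   ≤⟨ *≤* (ℤ.*-monoʳ-≤-nonNeg (ℤ.+ 1) (ℤ.+≤+ a≤b)) ⟩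
  mkℚᵘ (ℤ.+ b) 0   ≃⟨ toℚᵘ-ℕ→ℚ b ⟨
  toℚᵘ (ℕ→ℚ b)   ∎)
  where open ℚᵘ.≤-Reasoning

ℕ→ℚ-cancel-≤ : ∀ {a b} → ℕ→ℚ a ≤ℚ ℕ→ℚ b → a ≤ b
ℕ→ℚ-cancel-≤ {a} {b} h = unfold (begin
  mkℚᵘ (ℤ.+ a) 0   ≃⟨ toℚᵘ-ℕ→ℚ a ⟨
  toℚᵘ (ℕ→ℚ a)   ≤⟨ ℚ.toℚᵘ-mono-≤ h ⟩
  toℚᵘ (ℕ→ℚ b)   ≃⟨ toℚᵘ-ℕ→ℚ b ⟩
  mkℚᵘ (ℤ.+ b) 0   ∎)
  where
  open ℚᵘ.≤-Reasoning
  unfold : mkℚᵘ (ℤ.+ a) 0 ℚᵘ.≤ mkℚᵘ (ℤ.+ b) 0 → a ≤ b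
  unfold (*≤* q) = ℤ.drop‿+≤+ (ℤ.*-cancelʳ-≤-pos (ℤ.+ a) (ℤ.+ b) (ℤ.+ 1) q)

ℕ→ℚ-positive : ∀ a .{{_ : NonZero a}} → Positive (ℕ→ℚ a)
ℕ→ℚ-positive a = ℚ.normalize-pos a 1

module Rational (k r a b : ℕ) .{{_ : NonZero a}} .{{_ : NonZero b}}
  (count : ∀ n (G : LinearGraph r n) → a ^ k * n ^ (1 + k) ≤ m G ^ k →
    Σ (List (Subset (m G))) λ copies → Unique copies × All (IsCycleCopy (k + k ∸ 1) G) copies ×
      m G ^ (k + k) ≤ b * (length copies * n ^ (k + k))) where

  instance
    a-positive : Positive (ℕ→ℚ a)
    a-positive = ℕ→ℚ-positive a
    b-positive : Positive (ℕ→ℚ b)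
    b-positive = ℕ→ℚ-positive b
    b-nonZero : NonZeroℚ (ℕ→ℚ b)
    b-nonZero = ℚ.pos⇒nonZero (ℕ→ℚ b)

  c : ℚ
  c = 1/ ℕ→ℚ b

  instance
    c-positive : Positive c
    c-positive = ℚ.1/pos⇒pos (ℕ→ℚ b)
    c-nonNegative : NonNegative c
    c-nonNegative = ℚ.pos⇒nonNeg c

  k+k≡2k : k + k ≡ 2 * k
  k+k≡2k = cong (k +_) (sym (+-identityʳ k))

  hypothesis : ∀ n M → (ℕ→ℚ a ^ℚ k) *ℚ (ℕ→ℚ n ^ℚ (k + 1)) ≤ℚ (ℕ→ℚ M ^ℚ k) → a ^ k * n ^ (1 + k) ≤ M ^ k
  hypothesis n M h = ℕ→ℚ-cancel-≤ (begin
    ℕ→ℚ (a ^ k * n ^ (1 + k))              ≡⟨ ℕ→ℚ-* (a ^ k) (n ^ (1 + k)) ⟩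
    ℕ→ℚ (a ^ k) *ℚ ℕ→ℚ (n ^ (1 + k))       ≡⟨ cong₂ _*ℚ_ (ℕ→ℚ-^ a k) (trans (ℕ→ℚ-^ n (1 + k)) (cong (ℕ→ℚ n ^ℚ_) (+-comm 1 k))) ⟩
    (ℕ→ℚ a ^ℚ k) *ℚ (ℕ→ℚ n ^ℚ (k + 1))     ≤⟨ h ⟩
    ℕ→ℚ M ^ℚ k                             ≡⟨ ℕ→ℚ-^ M k ⟨
    ℕ→ℚ (M ^ k)                            ∎)
    where open ℚ.≤-Reasoning

  conclusion : ∀ n M N → M ^ (k + k) ≤ b * (N * n ^ (k + k)) →
    c *ℚ (ℕ→ℚ M ^ℚ (2 * k)) ≤ℚ ℕ→ℚ N *ℚ (ℕ→ℚ n ^ℚ (2 * k))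
  conclusion n M N h = begin
    c *ℚ (ℕ→ℚ M ^ℚ (2 * k))               ≡⟨ cong (c *ℚ_) (power M) ⟨
    c *ℚ ℕ→ℚ (M ^ (k + k))                ≤⟨ ℚ.*-monoˡ-≤-nonNeg c (ℕ→ℚ-mono-≤ h) ⟩
    c *ℚ ℕ→ℚ (b * q)                      ≡⟨ cong (c *ℚ_) (ℕ→ℚ-* b q) ⟩
    c *ℚ (ℕ→ℚ b *ℚ ℕ→ℚ q)                 ≡⟨ ℚ.*-assoc c (ℕ→ℚ b) (ℕ→ℚ q) ⟨
    (c *ℚ ℕ→ℚ b) *ℚ ℕ→ℚ q                 ≡⟨ cong (_*ℚ ℕ→ℚ q) (ℚ.*-inverseˡ (ℕ→ℚ b)) ⟩
    1ℚ *ℚ ℕ→ℚ q                           ≡⟨ ℚ.*-identityˡ (ℕ→ℚ q) ⟩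
    ℕ→ℚ q                                 ≡⟨ ℕ→ℚ-* N (n ^ (k + k)) ⟩
    ℕ→ℚ N *ℚ ℕ→ℚ (n ^ (k + k))            ≡⟨ cong (ℕ→ℚ N *ℚ_) (power n) ⟩
    ℕ→ℚ N *ℚ (ℕ→ℚ n ^ℚ (2 * k))           ∎
    where
    open ℚ.≤-Reasoning
    q = N * n ^ (k + k)
    power : ∀ x → ℕ→ℚ (x ^ (k + k)) ≡ ℕ→ℚ x ^ℚ (2 * k)
    power x = trans (ℕ→ℚ-^ x (k + k)) (cong (ℕ→ℚ x ^ℚ_) k+k≡2k)

  constants : Σ ℚ λ C → Σ ℚ λ c → (0ℚ <ℚ C) × (0ℚ <ℚ c) ×
    ((n : ℕ) (G : LinearGraph r n) →
    ((C ^ℚ k) *ℚ (ℕ→ℚ n ^ℚ (k + 1)) ≤ℚ (ℕ→ℚ (m G) ^ℚ k)) →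
    Σ (List (Subset (m G))) λ copies →
    Unique copies × All (IsCycleCopy (2 * k ∸ 1) G) copies ×
    (c *ℚ (ℕ→ℚ (m G) ^ℚ (2 * k)) ≤ℚ (ℕ→ℚ (length copies) *ℚ (ℕ→ℚ n ^ℚ (2 * k)))))
  constants = ℕ→ℚ a , c , ℚ.positive⁻¹ (ℕ→ℚ a) , ℚ.positive⁻¹ c , λ n G h →
    let (copies , unique , are-copies , bound) = count n G (hypothesis n (m G) h) in
    copies , unique , subst (λ L → All (IsCycleCopy (L ∸ 1) G) copies) k+k≡2k are-copies ,
    conclusion n (m G) (length copies) bound

theorem1p2 : (k r : ℕ) → 2 ≤ k → 2 ≤ r →
    Σ ℚ λ C → Σ ℚ λ c → (0ℚ <ℚ C) × (0ℚ <ℚ c) ×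
    ((n : ℕ) (G : LinearGraph r n) →
    ((C ^ℚ k) *ℚ (ℕ→ℚ n ^ℚ (k + 1)) ≤ℚ (ℕ→ℚ (m G) ^ℚ k)) →
    Σ (List (Subset (m G))) λ copies →
    Unique copies × All (IsCycleCopy (2 * k ∸ 1) G) copies ×
    (c *ℚ (ℕ→ℚ (m G) ^ℚ (2 * k)) ≤ℚ (ℕ→ℚ (length copies) *ℚ (ℕ→ℚ n ^ℚ (2 * k)))))
theorem1p2 k@(suc (suc p)) r (s≤s (s≤s z≤n)) 2≤r =
  Rational.constants k r a b {{a≢0}} {{b≢0}} (supersaturation p r 2≤r)
  where
  L = k + k
  -- The threshold `4 * s * (z * z)` of `bad-small` at `s = k * (r * r)` and `z = 2 * L`.
  a = 4 * (k * (r * r)) * ((2 * L) * (2 * L))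
  -- The 2 is for the half of the weight lost, `4 ^ k` for the eigenvalue bound, and `(L * r) ^ L`
  -- for the walks on one copy.
  b = 2 * 4 ^ k * (L * r) ^ L
  r≢0 : NonZero r
  r≢0 = >-nonZero (≤-trans (s≤s z≤n) 2≤r)
  a≢0 : NonZero a
  a≢0 = m*n≢0 (4 * (k * (r * r))) ((2 * L) * (2 * L))
    {{m*n≢0 4 (k * (r * r)) {{it}} {{m*n≢0 k (r * r) {{it}} {{m*n≢0 r r {{r≢0}} {{r≢0}}}}}}}}
  b≢0 : NonZero b
  b≢0 = m*n≢0 (2 * 4 ^ k) ((L * r) ^ L) {{m*n≢0 2 (4 ^ k) {{it}} {{m^n≢0 4 k}}}} {{m^n≢0 (L * r) L {{m*n≢0 L r {{it}} {{r≢0}}}}}}
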